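{- There is no structure $\langle\mathbb N,\oplus,\otimes\rangle$ with $\oplus,\otimes$ computable binary operations on $\mathbb N$, together with a co-c.e. equivalence relation $E$ on $\mathbb N$ that is a congruence with respect to $\oplus$ and $\otimes$, such that the quotient $\langle\mathbb N,\oplus,\otimes\rangle/E$ is a $\Sigma_1$-sound nonstandard model of arithmetic, or even merely a nonstandard model of arithmetic with $0'$ in its standard system.
   Context: "Model of arithmetic" means a model of Peano arithmetic (or a suitable fragment) in the language $\{+,\cdot\}$. A model $M$ is $\Sigma_1$-sound if every $\Sigma_1$ sentence true in $M$ is true in the standard natural numbers. The standard system of a nonstandard model $M$ of arithmetic is the collection of sets of the form $\{n\in\mathbb N : M\models \bar p_n \text{ divides } a\}$ for $a\in M$, where $p_n$ is the $n$-th prime and $\bar p_n$ is the element of $M$ representing it. $0'$ denotes the halting problem. Co-c.e. means the complement is computably enumerable. -}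

module Defs where

open import Data.Nat using (ℕ; zero; suc; _+_; _*_; _^_; _<_)
open import Data.Nat.Primality using (Prime; prime?)
open import Data.Fin using (Fin; toℕ) renaming (zero to fz; suc to fs)
open import Data.Vec using (Vec; []; _∷_; lookup)
open import Data.List using (List; length; filter; upTo)
open import Data.Product using (Σ; _×_)
open import Relation.Nullary using (¬_)
open import Relation.Binary.PropositionalEquality using (_≡_)

data PR : ℕ → Set where
  Z    : PR 0
  S    : PR 1
  proj : ∀ {n} → Fin n → PR n
  comp : ∀ {m n} → PR m → Vec (PR n) m → PR n
  prim : ∀ {n} → PR n → PR (suc (suc n)) → PR (suc n)
  mu   : ∀ {n} → PR (suc n) → PR n

mutual
  data Eval : ∀ {n} → PR n → Vec ℕ n → ℕ → Set where
    evZ    : Eval Z [] 0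
    evS    : ∀ {x} → Eval S (x ∷ []) (suc x)
    evProj : ∀ {n} {i : Fin n} {xs} → Eval (proj i) xs (lookup xs i)
    evComp : ∀ {m n} {f : PR m} {gs : Vec (PR n) m} {xs ys y} →
             EvalV gs xs ys → Eval f ys y → Eval (comp f gs) xs y
    evPrim0 : ∀ {n} {f : PR n} {g xs y} →
              Eval f xs y → Eval (prim f g) (0 ∷ xs) y
    evPrimS : ∀ {n} {f : PR n} {g xs k r y} →
              Eval (prim f g) (k ∷ xs) r → Eval g (k ∷ r ∷ xs) y →
              Eval (prim f g) (suc k ∷ xs) y
    evMu   : ∀ {n} {f : PR (suc n)} {xs y} →
             Eval f (y ∷ xs) 0 →
             (∀ z → z < y → Σ ℕ (λ k → Eval f (z ∷ xs) (suc k))) →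
             Eval (mu f) xs y

  data EvalV : ∀ {m n} → Vec (PR n) m → Vec ℕ n → Vec ℕ m → Set where
    []  : ∀ {n} {xs : Vec ℕ n} → EvalV [] xs []
    _∷_ : ∀ {m n} {g : PR n} {gs : Vec (PR n) m} {xs y ys} →
          Eval g xs y → EvalV gs xs ys → EvalV (g ∷ gs) xs (y ∷ ys)

Halts : ∀ {n} → PR n → Vec ℕ n → Set
Halts e xs = Σ ℕ (Eval e xs)

pair : ℕ → ℕ → ℕ
pair x y = (2 ^ x) * (2 * y + 1)

mutual
  code : ∀ {n} → PR n → ℕ
  code Z          = pair 0 0
  code S          = pair 1 0
  code (proj i)   = pair 2 (toℕ i)
  code (comp f gs) = pair 3 (pair (code f) (codes gs))
  code (prim f g) = pair 4 (pair (code f) (code g))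
  code (mu f)     = pair 5 (code f)

  codes : ∀ {m n} → Vec (PR n) m → ℕ
  codes []       = 0
  codes (g ∷ gs) = pair (code g) (codes gs)

HaltingSet : ℕ → Set
HaltingSet c = Σ (PR 1) (λ e → (code e ≡ c) × Halts e (c ∷ []))

Computable₂ : (ℕ → ℕ → ℕ) → Set
Computable₂ f = Σ (PR 2) (λ e → ∀ x y → Eval e (x ∷ y ∷ []) (f x y))

CoCE₂ : (ℕ → ℕ → Set) → Set
CoCE₂ R = Σ (PR 2) (λ e → ∀ x y →
            (¬ R x y → Halts e (x ∷ y ∷ [])) × (Halts e (x ∷ y ∷ []) → ¬ R x y))

Congruence₂ : (ℕ → ℕ → Set) → (ℕ → ℕ → ℕ) → (ℕ → ℕ → ℕ) → Set
Congruence₂ R _⊕_ _⊗_ =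
  (∀ {a a' b b'} → R a a' → R b b' → R (a ⊕ b) (a' ⊕ b')) ×
  (∀ {a a' b b'} → R a a' → R b b' → R (a ⊗ b) (a' ⊗ b'))

infixl 7 _*'_
infixl 6 _+'_
data Tm (n : ℕ) : Set where
  var  : Fin n → Tm n
  0'   : Tm n
  1'   : Tm n
  _+'_ : Tm n → Tm n → Tm n
  _*'_ : Tm n → Tm n → Tm n

infix 4 _≐_
infixr 3 _∧'_
data Fm : ℕ → Set where
  _≐_  : ∀ {n} → Tm n → Tm n → Fm n
  ¬'_  : ∀ {n} → Fm n → Fm n
  _∧'_ : ∀ {n} → Fm n → Fm n → Fm n
  ∀'_  : ∀ {n} → Fm (suc n) → Fm n

infixr 2 _⇒'_
_⇒'_ : ∀ {n} → Fm n → Fm n → Fm n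
φ ⇒' ψ = ¬' (φ ∧' ¬' ψ)

∃'_ : ∀ {n} → Fm (suc n) → Fm n
∃' φ = ¬' (∀' (¬' φ))

wk : ∀ {n} → Tm n → Tm (suc n)
wk (var i)  = var (fs i)
wk 0'       = 0'
wk 1'       = 1'
wk (t +' s) = wk t +' wk s
wk (t *' s) = wk t *' wk s

v0 : ∀ {n} → Tm (suc n)
v0 = var fz

v1 : ∀ {n} → Tm (suc (suc n))
v1 = var (fs fz)

∀≤ : ∀ {n} → Tm n → Fm (suc n) → Fm n
∀≤ t φ = ∀' ((∃' (v1 +' v0 ≐ wk (wk t))) ⇒' φ)

∃≤ : ∀ {n} → Tm n → Fm (suc n) → Fm n
∃≤ t φ = ¬' (∀≤ t (¬' φ))

data Δ₀ : ∀ {n} → Fm n → Set where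
  atom : ∀ {n} {t s : Tm n} → Δ₀ (t ≐ s)
  neg  : ∀ {n} {φ : Fm n} → Δ₀ φ → Δ₀ (¬' φ)
  conj : ∀ {n} {φ ψ : Fm n} → Δ₀ φ → Δ₀ ψ → Δ₀ (φ ∧' ψ)
  ball : ∀ {n} {t : Tm n} {φ : Fm (suc n)} → Δ₀ φ → Δ₀ (∀≤ t φ)

data Σ₁ : ∀ {n} → Fm n → Set where
  δ  : ∀ {n} {φ : Fm n} → Δ₀ φ → Σ₁ φ
  ex : ∀ {n} {φ : Fm (suc n)} → Σ₁ φ → Σ₁ (∃' φ)

record Str : Set₁ where
  field
    Carrier : Set
    _≈_     : Carrier → Carrier → Set
    _⊕_     : Carrier → Carrier → Carrier
    _⊗_     : Carrier → Carrier → Carrier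
    𝟘       : Carrier
    𝟙       : Carrier

module _ (M : Str) where
  open Str M

  extend : ∀ {n} → Carrier → (Fin n → Carrier) → Fin (suc n) → Carrier
  extend a ρ fz     = a
  extend a ρ (fs i) = ρ i

  ⟦_⟧ : ∀ {n} → Tm n → (Fin n → Carrier) → Carrier
  ⟦ var i ⟧  ρ = ρ i
  ⟦ 0' ⟧     ρ = 𝟘
  ⟦ 1' ⟧     ρ = 𝟙
  ⟦ t +' s ⟧ ρ = ⟦ t ⟧ ρ ⊕ ⟦ s ⟧ ρ
  ⟦ t *' s ⟧ ρ = ⟦ t ⟧ ρ ⊗ ⟦ s ⟧ ρ

  -- Gödel–Gentzen style: atoms are double-negated, so Sat is classical
  Sat : ∀ {n} → Fm n → (Fin n → Carrier) → Set
  Sat (t ≐ s)  ρ = ¬ ¬ (⟦ t ⟧ ρ ≈ ⟦ s ⟧ ρ)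
  Sat (¬' φ)   ρ = ¬ Sat φ ρ
  Sat (φ ∧' ψ) ρ = Sat φ ρ × Sat ψ ρ
  Sat (∀' φ)   ρ = ∀ a → Sat φ (extend a ρ)

  ε : Fin 0 → Carrier
  ε ()

  _⊨_ : Fm 0 → Set
  _⊨_ φ = Sat φ ε

  num : ℕ → Carrier
  num zero    = 𝟘
  num (suc n) = num n ⊕ 𝟙

PA-ax1 PA-ax2 PA-ax3 PA-ax4 PA-ax5 PA-ax6 : Fm 0
PA-ax1 = ∀' (¬' (v0 +' 1' ≐ 0'))
PA-ax2 = ∀' (∀' ((v1 +' 1' ≐ v0 +' 1') ⇒' (v1 ≐ v0)))
PA-ax3 = ∀' (v0 +' 0' ≐ v0)
PA-ax4 = ∀' (∀' (v1 +' (v0 +' 1') ≐ (v1 +' v0) +' 1'))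
PA-ax5 = ∀' (v0 *' 0' ≐ 0')
PA-ax6 = ∀' (∀' (v1 *' (v0 +' 1') ≐ (v1 *' v0) +' v1))

-- M ⊨ PA : the six basic axioms plus every instance of the induction scheme
-- (the instance for φ(x, ȳ), universally closed over the parameters ȳ)
ModelPA : Str → Set
ModelPA M =
  (M ⊨ PA-ax1) × (M ⊨ PA-ax2) × (M ⊨ PA-ax3) ×
  (M ⊨ PA-ax4) × (M ⊨ PA-ax5) × (M ⊨ PA-ax6) ×
  (∀ {n} (φ : Fm (suc n)) (ρ : Fin n → Carrier) →
     Sat M φ (extend M 𝟘 ρ) →
     (∀ a → Sat M φ (extend M a ρ) → Sat M φ (extend M (a ⊕ 𝟙) ρ)) →
     ∀ a → Sat M φ (extend M a ρ))
  where open Str M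

Nonstandard : Str → Set
Nonstandard M = ¬ (∀ a → ¬ (∀ n → ¬ (a ≈ num M n)))
  where open Str M

ℕ-Str : Str
ℕ-Str = record { Carrier = ℕ ; _≈_ = _≡_ ; _⊕_ = _+_ ; _⊗_ = _*_ ; 𝟘 = 0 ; 𝟙 = 1 }

Σ₁-Sound : Str → Set
Σ₁-Sound M = ∀ (φ : Fm 0) → Σ₁ φ → M ⊨ φ → ℕ-Str ⊨ φ

-- p is the n-th prime (p₀ = 2): p is prime and exactly n primes lie below p
NthPrime : ℕ → ℕ → Set
NthPrime n p = Prime p × (length (filter prime? (upTo p)) ≡ n)

DividesIn : (M : Str) → Str.Carrier M → Str.Carrier M → Set
DividesIn M d a = ¬ (∀ c → ¬ ((d ⊗ c) ≈ a))
  where open Str M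

ZeroJumpInSSy : Str → Set
ZeroJumpInSSy M = ¬ (∀ a → ¬ (∀ n p → NthPrime n p →
    (¬ ¬ HaltingSet n → DividesIn M (num M p) a) ×
    (DividesIn M (num M p) a → ¬ ¬ HaltingSet n)))
  where open Str M

-- the quotient structure ⟨ℕ, ⊕, ⊗⟩ / E, with chosen representatives of 0 and 1;
-- equality is interpreted by E (legitimate since E is a congruence)
Quotient : (ℕ → ℕ → ℕ) → (ℕ → ℕ → ℕ) → (ℕ → ℕ → Set) → ℕ → ℕ → Str
Quotient _⊕_ _⊗_ E z o = record
  { Carrier = ℕ ; _≈_ = E ; _⊕_ = _⊕_ ; _⊗_ = _⊗_ ; 𝟘 = z ; 𝟙 = o }

module Submission where

-- Every element of M = ⟨ℕ,⊕,⊗⟩/E is named by a natural number, so M can be diagonalised against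
-- itself. Read i as a triple (m , b , b′) of elements, which is a candidate for a separating pair
-- of sets: "the modulus 1 + (i + 1) m divides b", and the same for b′. Both statements have the
-- form ∃ standard witnesses such that two computed elements are E-equal. Under either hypothesis
-- some formula of M, possibly with a parameter, defines E on standard numbers: if M is Σ₁-sound,
-- "the program enumerating the complement of E never halts"; if a codes 0′, "a is not divisible
-- by the prime whose index is the code of that program with the two arguments hard-wired". Hence
-- "b′ is divided, by a witness smaller than any witness for b" is a formula inFirst(i) which is
-- correct for every standard i for which exactly one of b, b′ is divided. By overspill there are
-- m, b, b′ in M such that for every standard i exactly one of b, b′ is divided by 1 + (i + 1) m,
-- and it is b iff inFirst(i). The number i of that very triple is a contradiction.
--
-- Programs are represented by Σ₁ formulas whose bounded approximations are absolute between ℕ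
-- and M; a run of a primitive recursion is coded by Gödel's moduli as a set of pairs.

open import Defs
open import Data.Bool using (Bool; true; false; if_then_else_)
open import Data.Empty using (⊥; ⊥-elim)
open import Data.Fin using (Fin; toℕ; _↑ˡ_) renaming (zero to fz; suc to fs)
open import Data.Fin.Properties using (toℕ-injective)
open import Data.List using (List; []; _∷_; _++_; length; filter; upTo)
open import Data.List.Properties using (length-++; filter-++; upTo-∷ʳ; filter-accept; filter-reject)
open import Data.List.Relation.Unary.All using (All; []; _∷_)
open import Data.Nat
open import Data.Nat.Coprimality using (Coprime; coprime-divisor) renaming (sym to Coprime-sym)
open import Data.Nat.Divisibility
open import Data.Nat.ListAction using (product)
open import Data.Nat.Primality
open import Data.Nat.Primality.Factorisation using (module PrimeFactorisation; factorise)
open import Data.Nat.Properties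
open import Data.Product hiding (map)
open import Data.Sum using (_⊎_; inj₁; inj₂; [_,_])
open import Data.Unit using (⊤; tt)
open import Data.Vec using (Vec; []; _∷_; lookup; map)
open import Data.Vec.Relation.Binary.Pointwise.Inductive as Pointwise using (Pointwise; []; _∷_)
open import Function using (_∘_; id)
open import Relation.Binary.Definitions using (tri<; tri≈; tri>)
open import Relation.Binary.PropositionalEquality as ≡ hiding ([_])
open import Relation.Binary.Structures using (IsEquivalence)
open import Relation.Nullary
open import Relation.Nullary.Negation using (negated-stable; ¬¬-map)

-- Double negation and uniform bounds on initial segments

¬¬-bind : {A B : Set} → ¬ ¬ A → (A → ¬ ¬ B) → ¬ ¬ B
¬¬-bind m f k = m λ a → f a k

-- Double negation can be moved out of a finite conjunction constructively, by induction on the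
-- bound; this allows classical decisions about finitely many numbers at once.
¬¬-∀≤ : ∀ n {P : ℕ → Set} → (∀ k → k ≤ n → ¬ ¬ P k) → ¬ ¬ (∀ k → k ≤ n → P k)
¬¬-∀≤ zero    h ¬all = h 0 z≤n λ p → ¬all λ { 0 z≤n → p }
¬¬-∀≤ (suc n) {P} h ¬all =
  ¬¬-∀≤ n (λ k k≤n → h k (m≤n⇒m≤1+n k≤n)) λ below →
  h (suc n) ≤-refl λ top →
  ¬all λ k k≤1+n → [ (λ { (s≤s k≤n) → below k k≤n }) , (λ { refl → top }) ] (m≤n⇒m<n∨m≡n k≤1+n)

-- Finitely many thresholds have a maximum. This plays the role of collection when the instances of
-- a bounded universal quantifier each need their own bound on witnesses.
uniform-threshold : ∀ n {P : ℕ → ℕ → Set} →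
  (∀ k → k ≤ n → Σ ℕ λ c → ∀ j → c ≤ j → P k j) →
  Σ ℕ λ c → ∀ k → k ≤ n → ∀ j → c ≤ j → P k j
uniform-threshold zero h = let (c , p) = h 0 z≤n in c , λ { 0 z≤n → p }
uniform-threshold (suc n) h =
  let (c , p) = uniform-threshold n (λ k k≤n → h k (m≤n⇒m≤1+n k≤n))
      (d , q) = h (suc n) ≤-refl
  in c ⊔ d , λ k k≤1+n j le → [ (λ { (s≤s k≤n) → p k k≤n j (m⊔n≤o⇒m≤o c d le) })
                              , (λ { refl → q j (m⊔n≤o⇒n≤o c d le) }) ] (m≤n⇒m<n∨m≡n k≤1+n)

bounded-on-initial-segment : ∀ (f : ℕ → ℕ) n → Σ ℕ λ c → ∀ k → k ≤ n → f k ≤ c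
bounded-on-initial-segment f n =
  let (c , p) = uniform-threshold n {λ k j → f k ≤ j} (λ k _ → f k , λ _ → id)
  in c , λ k k≤n → p k k≤n c ≤-refl

-- Coded sets and iterations

-- A pairing that is a polynomial, hence a term of the language. With `s = k + r` its value lies
-- between `s * s` and `suc s * suc s`, which determines `s` and then `k`.
π : ℕ → ℕ → ℕ
π k r = (k + r) * (k + r) + k

π-mono : ∀ {k k′ r r′} → k ≤ k′ → r ≤ r′ → π k r ≤ π k′ r′
π-mono p q = +-mono-≤ (*-mono-≤ (+-mono-≤ p q) (+-mono-≤ p q)) p

π-<-sum : ∀ k r k′ r′ → k + r < k′ + r′ → π k r < π k′ r′
π-<-sum k r k′ r′ lt = begin-strict
  s * s + k       ≤⟨ +-monoʳ-≤ (s * s) (m≤m+n k r) ⟩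
  s * s + s       ≡⟨ +-comm (s * s) s ⟩
  suc s * s       <⟨ *-monoʳ-< (suc s) (n<1+n s) ⟩
  suc s * suc s   ≤⟨ *-mono-≤ lt lt ⟩
  s′ * s′         ≤⟨ m≤m+n (s′ * s′) k′ ⟩
  s′ * s′ + k′    ∎
  where
  open ≤-Reasoning
  s = k + r
  s′ = k′ + r′

π-injective : ∀ k r k′ r′ → π k r ≡ π k′ r′ → k ≡ k′ × r ≡ r′
π-injective k r k′ r′ eq with <-cmp (k + r) (k′ + r′)
... | tri< lt _ _ = contradiction eq (<⇒≢ (π-<-sum k r k′ r′ lt))
... | tri> _ _ gt = contradiction (sym eq) (<⇒≢ (π-<-sum k′ r′ k r gt))
... | tri≈ _ s≡s′ _ = k≡k′ , +-cancelˡ-≡ k r r′ (trans s≡s′ (cong (_+ r′) (sym k≡k′)))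
  where
  k≡k′ : k ≡ k′
  k≡k′ = +-cancelˡ-≡ ((k + r) * (k + r)) k k′ (trans eq (cong (λ s → s * s + k′) (sym s≡s′)))

-- Gödel's moduli, pairwise coprime for x ≤ n when m = n!.
modulus : ℕ → ℕ → ℕ
modulus m x = 1 + (x + 1) * m

-- (m , b) codes the set of those x whose modulus divides b.
Member : ℕ → ℕ → ℕ → Set
Member x m b = Σ ℕ λ c → modulus m x * c ≡ b

Member⇒∣ : ∀ {x m b} → Member x m b → modulus m x ∣ b
Member⇒∣ {x} {m} (c , eq) = divides c (trans (sym eq) (*-comm (modulus m x) c))

∣⇒Member : ∀ {x m b} → modulus m x ∣ b → Member x m b
∣⇒Member {x} {m} (divides c eq) = c , trans (*-comm (modulus m x) c) (sym eq)

1≤k≤n⇒k∣n! : ∀ {k n} → 1 ≤ k → k ≤ n → k ∣ n !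
1≤k≤n⇒k∣n! {suc k} _ k≤n = ∣-trans (m∣m*n (k !)) (m≤n⇒m!∣n! k≤n)

∣modulus⇒coprime : ∀ {d m} x → d ∣ modulus m x → Coprime d m
∣modulus⇒coprime {d} x d∣u {e} (e∣d , e∣m) =
  ∣1⇒≡1 (∣m+n∣m⇒∣n (subst (e ∣_) (+-comm 1 ((x + 1) * _)) (∣-trans e∣d d∣u)) (∣n⇒∣m*n (x + 1) e∣m))

modulus-split : ∀ m x k → modulus m (x + k) ≡ modulus m x + k * m
modulus-split m x k = cong suc (begin
  (x + k + 1) * m       ≡⟨ cong (_* m) (trans (+-assoc x k 1) (trans (cong (x +_) (+-comm k 1)) (sym (+-assoc x 1 k)))) ⟩
  (x + 1 + k) * m       ≡⟨ *-distribʳ-+ m (x + 1) k ⟩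
  (x + 1) * m + k * m   ∎)
  where open ≡-Reasoning

-- A common divisor `d` divides the difference `k * n !`, hence `n ! * n !` because `0 < k ≤ n`.
-- Being coprime to `n !`, it divides `n !`, and so it is 1.
modulus-coprime-< : ∀ {n x y} → x < y → y ≤ n → Coprime (modulus (n !) x) (modulus (n !) y)
modulus-coprime-< {n} {x} {y} x<y y≤n {d} (d∣u , d∣v) = coprime (∣-refl , d∣m)
  where
  k = y ∸ x
  coprime : Coprime d (n !)
  coprime = ∣modulus⇒coprime x d∣u
  d∣km : d ∣ k * n !
  d∣km = ∣m+n∣m⇒∣n (subst (d ∣_) (trans (cong (modulus (n !)) (sym (m+[n∸m]≡n (<⇒≤ x<y)))) (modulus-split (n !) x k)) d∣v) d∣u
  d∣m : d ∣ n !
  d∣m = coprime-divisor coprime (∣-trans d∣km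
          (*-monoˡ-∣ (n !) (1≤k≤n⇒k∣n! (m<n⇒0<n∸m x<y) (≤-trans (m∸n≤m y x) y≤n))))

modulus-coprime : ∀ {n x y} → x ≤ n → y ≤ n → x ≢ y → Coprime (modulus (n !) x) (modulus (n !) y)
modulus-coprime {n} {x} {y} x≤n y≤n x≢y with <-cmp x y
... | tri< x<y _ _ = modulus-coprime-< x<y y≤n
... | tri≈ _ x≡y _ = contradiction x≡y x≢y
... | tri> _ _ y<x = Coprime-sym (modulus-coprime-< y<x x≤n)

module _ (P : ℕ → Set) (P? : ∀ x → Dec (P x)) (N : ℕ) where

  private
    u : ℕ → ℕ
    u = modulus (N !)

    factor : ∀ x → Dec (P x) → ℕ
    factor x (yes _) = u x
    factor x (no  _) = 1

    prod : ℕ → ℕ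
    prod zero    = 1
    prod (suc n) = factor n (P? n) * prod n

    ∣prod : ∀ n {x} → x < n → P x → u x ∣ prod n
    ∣prod (suc n) {x} (s≤s x≤n) px with m≤n⇒m<n∨m≡n x≤n
    ... | inj₁ x<n = ∣n⇒∣m*n (factor n (P? n)) (∣prod n x<n px)
    ... | inj₂ refl with P? x
    ...   | yes _  = m∣m*n (prod x)
    ...   | no ¬px = contradiction px ¬px

    -- Factors are cancelled one at a time: a modulus of another index is coprime to `u x`. What
    -- would remain, `u x ∣ 1`, is impossible because `x + 1` and `N !` are positive.
    ∣prod⁻¹ : ∀ n {x} → n ≤ suc N → x ≤ N → u x ∣ prod n → P x
    ∣prod⁻¹ zero {x} _ _ u∣1 =
      contradiction (m*n≡0⇒m≡0∨n≡0 (x + 1) (suc-injective (∣1⇒≡1 u∣1)))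
        [ (λ eq → 1+n≢0 (trans (+-comm 1 x) eq)) , (λ eq → n≮0 (subst (1 ≤_) eq (1≤n! N))) ]
    ∣prod⁻¹ (suc n) {x} (s≤s n≤N) x≤N u∣ with P? n
    ... | no _ = ∣prod⁻¹ n (m≤n⇒m≤1+n n≤N) x≤N (subst (u x ∣_) (*-identityˡ (prod n)) u∣)
    ... | yes pn with x ≟ n
    ...   | yes refl = pn
    ...   | no x≢n = ∣prod⁻¹ n (m≤n⇒m≤1+n n≤N) x≤N (coprime-divisor (modulus-coprime x≤N n≤N x≢n) u∣)

  code-set : Σ ℕ λ b → ∀ x → x ≤ N → (P x → Member x (N !) b) × (Member x (N !) b → P x)
  code-set = prod (suc N) , λ x x≤N →
    (λ px → ∣⇒Member {x} (∣prod (suc N) (s≤s x≤N) px)) ,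
    (λ mem → ∣prod⁻¹ (suc N) ≤-refl x≤N (Member⇒∣ {x} mem))

-- A common form of primitive recursion and of counting primes, so that one coding by moduli and one
-- formula serve both.
data Iter (F : ℕ → Set) (G : ℕ → ℕ → ℕ → Set) : ℕ → ℕ → Set where
  base : ∀ {y} → F y → Iter F G 0 y
  step : ∀ {k r y} → Iter F G k r → G k r y → Iter F G (suc k) y

module _ {F : ℕ → Set} {G : ℕ → ℕ → ℕ → Set} where

  Trace : ℕ → ℕ → (ℕ → ℕ) → Set
  Trace n y f = F (f 0) × (∀ k → k < n → G k (f k) (f (suc k))) × f n ≡ y

  trace : ∀ {n y} → Iter F G n y → Σ (ℕ → ℕ) (Trace n y)
  trace {y = y} (base p) = (λ _ → y) , p , (λ _ ()) , refl
  trace {suc n} {y} (step it g) with trace it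
  ... | f , f0 , next , refl = f′ , subst F (sym (below z≤n)) f0 , steps , above
    where
    f′ : ℕ → ℕ
    f′ k with k ≤? n
    ... | yes _ = f k
    ... | no  _ = y
    below : ∀ {k} → k ≤ n → f′ k ≡ f k
    below {k} k≤n with k ≤? n
    ... | yes _ = refl
    ... | no k≰n = contradiction k≤n k≰n
    above : f′ (suc n) ≡ y
    above with suc n ≤? n
    ... | yes lt = contradiction lt (n≮n n)
    ... | no  _  = refl
    steps : ∀ k → k < suc n → G k (f′ k) (f′ (suc k))
    steps k (s≤s k≤n) with m≤n⇒m<n∨m≡n k≤n
    ... | inj₁ k<n = subst₂ (G k) (sym (below k≤n)) (sym (below k<n)) (next k k<n)
    ... | inj₂ refl = subst₂ (G k) (sym (below k≤n)) (sym above) g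

  -- (m , b) codes a set of pairs (k , r) with r ≤ c that contains the graph of the
  -- iteration up to n and, at n, nothing but y.
  IsIterCode : ℕ → ℕ → ℕ → ℕ → ℕ → Set
  IsIterCode n y m b c =
    (Σ ℕ λ y₀ → y₀ ≤ c × F y₀ × Member (π 0 y₀) m b) ×
    (∀ k → k ≤ n → k ≡ n ⊎ (∀ r → r ≤ c → ¬ Member (π k r) m b ⊎
       (Σ ℕ λ r′ → r′ ≤ c × G k r r′ × Member (π (suc k) r′) m b))) ×
    (∀ r → r ≤ c → ¬ Member (π n r) m b ⊎ r ≡ y)

  -- The coded set may hold several values at one stage. A path is chosen from `y₀` upwards, stage
  -- by stage, and the last clause forces it to end in `y`.
  IsIterCode⇒Iter : ∀ {n y} m b c → IsIterCode n y m b c → Iter F G n y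
  IsIterCode⇒Iter {n} {y} m b c ((y₀ , y₀≤c , f0 , mem₀) , next , last) = finish (upto n ≤-refl)
    where
    upto : ∀ k → k ≤ n → Σ ℕ λ r → r ≤ c × Iter F G k r × Member (π k r) m b
    upto zero _ = y₀ , y₀≤c , base f0 , mem₀
    upto (suc k) k<n with upto k (<⇒≤ k<n)
    ... | r , r≤c , it , mem with next k (<⇒≤ k<n)
    ...   | inj₁ k≡n = contradiction k≡n (<⇒≢ k<n)
    ...   | inj₂ h with h r r≤c
    ...     | inj₁ ¬mem = contradiction mem ¬mem
    ...     | inj₂ (r′ , r′≤c , g , mem′) = r′ , r′≤c , step it g , mem′
    finish : (Σ ℕ λ r → r ≤ c × Iter F G n r × Member (π n r) m b) → Iter F G n y
    finish (r , r≤c , it , mem) with last r r≤c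
    ... | inj₁ ¬mem = contradiction mem ¬mem
    ... | inj₂ refl = it

  Iter⇒IsIterCode : ∀ {n y} → Iter F G n y → Σ ℕ λ m → Σ ℕ λ b → Σ ℕ λ c → IsIterCode n y m b c
  Iter⇒IsIterCode {n} {y} it with trace it
  ... | f , f0 , f-next , refl =
    N ! , b , c , (f 0 , f≤c 0 z≤n , f0 , member 0 z≤n) , next ,
    λ r r≤c → at n ≤-refl r r≤c
    where
    c = proj₁ (bounded-on-initial-segment f n)
    f≤c = proj₂ (bounded-on-initial-segment f n)
    -- By monotonicity every `π k r` with `k ≤ n` and `r ≤ c` is at most `N`, where the coding is
    -- exact.
    N = π n c
    OnTrace : ℕ → Set
    OnTrace x = Σ ℕ λ k → k < suc n × x ≡ π k (f k)
    coded = code-set OnTrace (λ x → anyUpTo? (λ k → x ≟ π k (f k)) (suc n)) N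
    b = proj₁ coded
    member : ∀ k → k ≤ n → Member (π k (f k)) (N !) b
    member k k≤n = proj₁ (proj₂ coded _ (π-mono k≤n (f≤c k k≤n))) (k , s≤s k≤n , refl)
    at : ∀ k → k ≤ n → ∀ r → r ≤ c → ¬ Member (π k r) (N !) b ⊎ r ≡ f k
    at k k≤n r r≤c with r ≟ f k
    ... | yes eq = inj₂ eq
    ... | no neq = inj₁ λ mem → case (proj₂ (proj₂ coded _ (π-mono k≤n r≤c)) mem)
      where
      case : OnTrace (π k r) → ⊥
      case (k′ , _ , eq) with π-injective k r k′ (f k′) eq
      ... | refl , r≡ = neq r≡
    next : ∀ k → k ≤ n → k ≡ n ⊎ (∀ r → r ≤ c → ¬ Member (π k r) (N !) b ⊎
             (Σ ℕ λ r′ → r′ ≤ c × G k r r′ × Member (π (suc k) r′) (N !) b))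
    next k k≤n with m≤n⇒m<n∨m≡n k≤n
    ... | inj₂ eq = inj₁ eq
    ... | inj₁ k<n = inj₂ λ r r≤c → [ inj₁ , (λ { refl → inj₂ (f (suc k) , f≤c (suc k) k<n , f-next k k<n , member (suc k) k<n) }) ] (at k k≤n r r≤c)

-- Counting primes

-- The shift by two leaves only nontrivial factors, and both factors are bounded, so that primality
-- is expressed by the bounded formula `primeᶠ`.
NoProduct : ℕ → Set
NoProduct p = ∀ a → a ≤ p → ∀ b → b ≤ p → ¬ (suc (suc a) * suc (suc b) ≡ p)

IsPrime : ℕ → Set
IsPrime p = (¬ (p ≡ 0) × ¬ (p ≡ 1)) × NoProduct p

prime⇒IsPrime : ∀ {p} → Prime p → IsPrime p
prime⇒IsPrime {p} pr = ((λ { refl → ¬prime[0] pr }) , (λ { refl → ¬prime[1] pr })) ,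
  λ a _ b _ eq → Prime.notComposite pr
    (hasNonTrivialDivisor {divisor = suc (suc a)}
      (subst (suc (suc a) <_) eq (m<m*n (suc (suc a)) (suc (suc b)) (s≤s (s≤s z≤n))))
      (divides (suc (suc b)) (trans (sym eq) (*-comm (suc (suc a)) (suc (suc b))))))

IsPrime⇒prime : ∀ {p} → IsPrime p → Prime p
IsPrime⇒prime {0} ((p≢0 , _) , _) = contradiction refl p≢0
IsPrime⇒prime {1} ((_ , p≢1) , _) = contradiction refl p≢1
IsPrime⇒prime {p@(suc (suc _))} (_ , noProd) = prime notComp
  where
  notComp : ¬ Composite p
  notComp (hasNonTrivialDivisor {divisor = suc (suc a)} d<p (divides 0 ()))
  notComp (hasNonTrivialDivisor {divisor = suc (suc a)} d<p (divides 1 eq)) = <⇒≢ d<p (sym (trans eq (+-identityʳ _)))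
  notComp (hasNonTrivialDivisor {divisor = suc (suc a)} d<p (divides (suc (suc b)) eq)) =
    noProd b (≤-trans (m≤n+m b 2) (≤-trans (m≤m*n _ (suc (suc a))) (≤-reflexive (sym eq))))
           a (≤-trans (m≤n+m a 2) (<⇒≤ d<p)) (sym eq)

primeCount : ℕ → ℕ
primeCount n = length (filter prime? (upTo n))

primeCount-suc : ∀ n → primeCount (suc n) ≡ primeCount n + length (filter prime? (n ∷ []))
primeCount-suc n = begin
  primeCount (suc n)                                              ≡⟨ cong (length ∘ filter prime?) (sym (upTo-∷ʳ n)) ⟩
  length (filter prime? (upTo n ++ n ∷ []))                       ≡⟨ cong length (filter-++ prime? (upTo n) (n ∷ [])) ⟩
  length (filter prime? (upTo n) ++ filter prime? (n ∷ []))       ≡⟨ length-++ (filter prime? (upTo n)) ⟩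
  primeCount n + length (filter prime? (n ∷ []))                  ∎
  where open ≡-Reasoning

primeCount-prime : ∀ {n} → Prime n → primeCount (suc n) ≡ suc (primeCount n)
primeCount-prime {n} pn = trans (primeCount-suc n)
  (trans (cong (λ l → primeCount n + length l) (filter-accept prime? pn)) (+-comm (primeCount n) 1))

primeCount-nonprime : ∀ {n} → ¬ Prime n → primeCount (suc n) ≡ primeCount n
primeCount-nonprime {n} ¬pn = trans (primeCount-suc n)
  (trans (cong (λ l → primeCount n + length l) (filter-reject prime? ¬pn)) (+-identityʳ (primeCount n)))

-- Casts prime counting as an iteration, through which `iterᴮ` can express that a number is the
-- prime of a given index.
CountStep : ℕ → ℕ → ℕ → Set
CountStep k r r′ = (IsPrime k × r′ ≡ suc r) ⊎ (¬ IsPrime k × r′ ≡ r)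

Iter⇒primeCount : ∀ {n y} → Iter (_≡ 0) CountStep n y → primeCount n ≡ y
Iter⇒primeCount (base refl) = refl
Iter⇒primeCount (step it (inj₁ (pr , refl))) =
  trans (primeCount-prime (IsPrime⇒prime pr)) (cong suc (Iter⇒primeCount it))
Iter⇒primeCount (step it (inj₂ (¬pr , refl))) =
  trans (primeCount-nonprime (¬pr ∘ prime⇒IsPrime)) (Iter⇒primeCount it)

primeCount⇒Iter : ∀ n → Iter (_≡ 0) CountStep n (primeCount n)
primeCount⇒Iter zero = base refl
primeCount⇒Iter (suc n) with prime? n
... | yes pn = step (primeCount⇒Iter n) (inj₁ (prime⇒IsPrime pn , primeCount-prime pn))
... | no ¬pn = step (primeCount⇒Iter n) (inj₂ (¬pn ∘ IsPrime⇒prime , primeCount-nonprime ¬pn))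

-- Euclid's argument: a prime factor of `suc (n !)` cannot be at most `n`.
prime-above : ∀ n → Σ ℕ λ p → Prime p × n < p
prime-above n = go (PrimeFactorisation.factors f) (PrimeFactorisation.isFactorisation f) (PrimeFactorisation.factorsPrime f)
  where
  f = factorise (suc (n !))
  go : ∀ ps → suc (n !) ≡ product ps → All Prime ps → Σ ℕ λ p → Prime p × n < p
  go [] eq _ = contradiction (subst (1 ≤_) (suc-injective eq) (1≤n! n)) n≮0
  go (p ∷ ps) eq (pp ∷ _) = p , pp , ≰⇒> λ p≤n →
    ¬prime[1] (subst Prime (∣1⇒≡1 (∣m+n∣m⇒∣n
      (subst (p ∣_) (trans (sym eq) (+-comm 1 (n !))) (m∣m*n (product ps)))
      (1≤k≤n⇒k∣n! (>-nonZero⁻¹ p {{prime⇒nonZero pp}}) p≤n))) pp)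

primeCount-mono-≤ : ∀ {m n} → m ≤ n → primeCount m ≤ primeCount n
primeCount-mono-≤ {m} m≤n = go (≤⇒≤′ m≤n)
  where
  go : ∀ {n} → m ≤′ n → primeCount m ≤ primeCount n
  go ≤′-refl = ≤-refl
  go {suc n} (≤′-step le) = ≤-trans (go le) (subst (primeCount n ≤_) (sym (primeCount-suc n)) (m≤m+n _ _))

primeCount-unbounded : ∀ n → Σ ℕ λ k → n ≤ primeCount k
primeCount-unbounded zero = 0 , z≤n
primeCount-unbounded (suc n) =
  let (k , n≤) = primeCount-unbounded n
      (p , pp , k<p) = prime-above k
  in suc p , subst (suc n ≤_) (sym (primeCount-prime pp)) (s≤s (≤-trans n≤ (primeCount-mono-≤ (<⇒≤ k<p))))

-- Descending from a `k` with more than `n` primes below it, the count drops to `n` exactly when a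
-- prime is passed, and that prime is the one sought.
nthPrime : ∀ n → Σ ℕ (NthPrime n)
nthPrime n = let (k , n<) = primeCount-unbounded (suc n) in search k n<
  where
  search : ∀ k → n < primeCount k → Σ ℕ (NthPrime n)
  search (suc k) lt with n <? primeCount k
  ... | yes lt′ = search k lt′
  ... | no ¬lt with prime? k
  ...   | yes pk = k , pk , ≤-antisym (≮⇒≥ ¬lt) (s≤s⁻¹ (subst (n <_) (primeCount-prime pk) lt))
  ...   | no ¬pk = contradiction (subst (n <_) (primeCount-nonprime ¬pk) lt) ¬lt

-- Σ₁ formulas for graphs of programs

v2 : ∀ {n} → Tm (3 + n)
v2 = wk v1

v3 : ∀ {n} → Tm (4 + n)
v3 = wk v2

v4 : ∀ {n} → Tm (5 + n)
v4 = wk v3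

v5 : ∀ {n} → Tm (6 + n)
v5 = wk v4

v6 : ∀ {n} → Tm (7 + n)
v6 = wk v5

wks : ∀ {n} m → Tm n → Tm (m + n)
wks zero    t = t
wks (suc m) t = wk (wks m t)

vars : ∀ {n} m → Vec (Tm (m + n)) m
vars zero    = []
vars (suc m) = v0 ∷ map wk (vars m)

-- Σ₁ formulas, presented so that bounding the unbounded existential quantifiers (and
-- only those) by a term s yields a formula of arithmetic.
data BFm : ℕ → Set where
  constᴮ    : ∀ {n} → Fm n → BFm n
  _∧ᴮ_ _∨ᴮ_ : ∀ {n} → BFm n → BFm n → BFm n
  ∃ᴮ        : ∀ {n} → BFm (suc n) → BFm n
  ∃≤ᴮ ∀≤ᴮ   : ∀ {n} → Tm n → BFm (suc n) → BFm n

infixr 3 _∧ᴮ_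
infixr 2 _∨'_ _∨ᴮ_

_∨'_ : ∀ {n} → Fm n → Fm n → Fm n
φ ∨' ψ = ¬' (¬' φ ∧' ¬' ψ)

infix 8 _⟨_⟩
_⟨_⟩ : ∀ {n} → BFm n → Tm n → Fm n
constᴮ φ ⟨ s ⟩  = φ
(φ ∧ᴮ ψ) ⟨ s ⟩  = φ ⟨ s ⟩ ∧' ψ ⟨ s ⟩
(φ ∨ᴮ ψ) ⟨ s ⟩  = φ ⟨ s ⟩ ∨' ψ ⟨ s ⟩
∃ᴮ φ ⟨ s ⟩      = ∃≤ s (φ ⟨ wk s ⟩)
∃≤ᴮ t φ ⟨ s ⟩   = ∃≤ t (φ ⟨ wk s ⟩)
∀≤ᴮ t φ ⟨ s ⟩   = ∀≤ t (φ ⟨ wk s ⟩)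

AllΔ₀ : ∀ {n} → BFm n → Set
AllΔ₀ (constᴮ φ) = Δ₀ φ
AllΔ₀ (φ ∧ᴮ ψ)   = AllΔ₀ φ × AllΔ₀ ψ
AllΔ₀ (φ ∨ᴮ ψ)   = AllΔ₀ φ × AllΔ₀ ψ
AllΔ₀ (∃ᴮ φ)     = AllΔ₀ φ
AllΔ₀ (∃≤ᴮ _ φ)  = AllΔ₀ φ
AllΔ₀ (∀≤ᴮ _ φ)  = AllΔ₀ φ

⟨⟩-Δ₀ : ∀ {n} (φ : BFm n) → AllΔ₀ φ → ∀ s → Δ₀ (φ ⟨ s ⟩)
⟨⟩-Δ₀ (constᴮ φ) d       s = d
⟨⟩-Δ₀ (φ ∧ᴮ ψ)   (d , e) s = conj (⟨⟩-Δ₀ φ d s) (⟨⟩-Δ₀ ψ e s)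
⟨⟩-Δ₀ (φ ∨ᴮ ψ)   (d , e) s = neg (conj (neg (⟨⟩-Δ₀ φ d s)) (neg (⟨⟩-Δ₀ ψ e s)))
⟨⟩-Δ₀ (∃ᴮ φ)     d       s = neg (ball {t = s} (neg (⟨⟩-Δ₀ φ d (wk s))))
⟨⟩-Δ₀ (∃≤ᴮ t φ)  d       s = neg (ball {t = t} (neg (⟨⟩-Δ₀ φ d (wk s))))
⟨⟩-Δ₀ (∀≤ᴮ t φ)  d       s = ball {t = t} (⟨⟩-Δ₀ φ d (wk s))

∃ᴮ* : ∀ {n} m → BFm (m + n) → BFm n
∃ᴮ* zero    φ = φ
∃ᴮ* (suc m) φ = ∃ᴮ* m (∃ᴮ φ)

πᵗ : ∀ {n} → Tm n → Tm n → Tm n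
πᵗ k r = (k +' r) *' (k +' r) +' k

memberVia : ∀ {n} → Tm n → Tm n → Tm n → Fm (suc n)
memberVia x m b = (1' +' (wk x +' 1') *' wk m) *' v0 ≐ wk b

member : ∀ {n} → Tm n → Tm n → Tm n → Fm n
member x m b = ∃≤ b (memberVia x m b)

-- Transcribes `IsIterCode`; under the three outer quantifiers `v2`, `v1`, `v0` are `m`, `b`, `c`.
-- Implications are written as disjunctions with a negated membership, so that `φ` and `ψ` occur
-- only positively.
iterᴮ : ∀ {n} → BFm (4 + n) → BFm (6 + n) → Tm n → Tm n → BFm n
iterᴮ φ ψ n y = ∃ᴮ* 3
  (  ∃≤ᴮ v0 (φ ∧ᴮ constᴮ (member (πᵗ 0' v0) v3 v2))
  ∧ᴮ ∀≤ᴮ (wks 3 n) (constᴮ (v0 ≐ wks 4 n) ∨ᴮ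
       ∀≤ᴮ v1 (constᴮ (¬' member (πᵗ v1 v0) v4 v3) ∨ᴮ
         ∃≤ᴮ v2 (ψ ∧ᴮ constᴮ (member (πᵗ (v2 +' 1') v0) v5 v4))))
  ∧ᴮ ∀≤ᴮ v0 (constᴮ (¬' member (πᵗ (wks 4 n) v0) v3 v2) ∨ᴮ constᴮ (v0 ≐ wks 4 y)))

primeᶠ : ∀ {n} → Tm n → Fm n
primeᶠ x = (¬' (x ≐ 0') ∧' ¬' (x ≐ 1')) ∧' ∀≤ x (∀≤ (wk x) (product≢ x))
  where
  product≢ : ∀ {n} → Tm n → Fm (2 + n)
  product≢ x = ¬' (((v1 +' 1') +' 1') *' ((v0 +' 1') +' 1') ≐ wk (wk x))

primeCountᴮ : ∀ {n} → Tm n → Tm n → BFm n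
primeCountᴮ = iterᴮ (constᴮ (v0 ≐ 0'))
  (constᴮ (primeᶠ v2) ∧ᴮ constᴮ (v0 ≐ v1 +' 1') ∨ᴮ constᴮ (¬' primeᶠ v2) ∧ᴮ constᴮ (v0 ≐ v1))

mutual
  -- Inputs and output are terms, so composition needs no substitution into formulas. For `mu`, a
  -- value is said to be positive by being `v0 +' 1'`; the disjunct `v0 ≐ wk y` removes the
  -- endpoint, which the bounded quantifier includes.
  graph : ∀ {N n} → PR n → Vec (Tm N) n → Tm N → BFm N
  graph Z          []       y = constᴮ (y ≐ 0')
  graph S          (x ∷ []) y = constᴮ (y ≐ x +' 1')
  graph (proj i)   xs       y = constᴮ (y ≐ lookup xs i)
  graph (comp {m} f gs) xs  y = ∃ᴮ* m (graphs gs (map (wks m) xs) (vars m) ∧ᴮ graph f (vars m) (wks m y))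
  graph (prim f g) (n ∷ xs) y =
    iterᴮ (graph f (map (wks 4) xs) v0) (graph g (v2 ∷ v1 ∷ map (wks 6) xs) v0) n y
  graph (mu f)     xs       y = graph f (y ∷ xs) 0' ∧ᴮ
    ∀≤ᴮ y (constᴮ (v0 ≐ wk y) ∨ᴮ ∃ᴮ (graph f (v1 ∷ map (wks 2) xs) (v0 +' 1')))

  graphs : ∀ {N n m} → Vec (PR n) m → Vec (Tm N) n → Vec (Tm N) m → BFm N
  graphs []       xs []       = constᴮ (0' ≐ 0')
  graphs (g ∷ gs) xs (y ∷ ys) = graph g xs y ∧ᴮ graphs gs xs ys

member-Δ₀ : ∀ {n} (x m b : Tm n) → Δ₀ (member x m b)
member-Δ₀ x m b = neg (ball {t = b} (neg atom))

∃ᴮ*-Δ₀ : ∀ {n} m {φ : BFm (m + n)} → AllΔ₀ φ → AllΔ₀ (∃ᴮ* m φ)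
∃ᴮ*-Δ₀ zero    d = d
∃ᴮ*-Δ₀ (suc m) d = ∃ᴮ*-Δ₀ m d

iterᴮ-Δ₀ : ∀ {N} {φ : BFm (4 + N)} {ψ} n y → AllΔ₀ φ → AllΔ₀ ψ → AllΔ₀ (iterᴮ φ ψ n y)
iterᴮ-Δ₀ n y d e =
  (d , member-Δ₀ (πᵗ 0' v0) v3 v2) ,
  (atom , neg (member-Δ₀ (πᵗ v1 v0) v4 v3) , e , member-Δ₀ (πᵗ (v2 +' 1') v0) v5 v4) ,
  neg (member-Δ₀ (πᵗ (wks 4 n) v0) v3 v2) , atom

mutual
  graph-Δ₀ : ∀ {N n} (e : PR n) (xs : Vec (Tm N) n) y → AllΔ₀ (graph e xs y)
  graph-Δ₀ Z          []       y = atom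
  graph-Δ₀ S          (x ∷ []) y = atom
  graph-Δ₀ (proj i)   xs       y = atom
  graph-Δ₀ (comp {m} f gs) xs  y = ∃ᴮ*-Δ₀ m (graphs-Δ₀ gs _ _ , graph-Δ₀ f _ _)
  graph-Δ₀ (prim f g) (n ∷ xs) y = iterᴮ-Δ₀ {φ = graph f _ _} {graph g _ _} n y (graph-Δ₀ f _ _) (graph-Δ₀ g _ _)
  graph-Δ₀ (mu f)     xs       y = graph-Δ₀ f _ _ , atom , graph-Δ₀ f _ _

  graphs-Δ₀ : ∀ {N n m} (gs : Vec (PR n) m) (xs : Vec (Tm N) n) ys → AllΔ₀ (graphs gs xs ys)
  graphs-Δ₀ []       xs []       = atom
  graphs-Δ₀ (g ∷ gs) xs (y ∷ ys) = graph-Δ₀ g xs y , graphs-Δ₀ gs xs ys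

Iter⇒Eval : ∀ {n f g} {xs : Vec ℕ n} {k y} →
  Iter (Eval f xs) (λ k r r′ → Eval g (k ∷ r ∷ xs) r′) k y → Eval (prim f g) (k ∷ xs) y
Iter⇒Eval (base ev)    = evPrim0 ev
Iter⇒Eval (step it ev) = evPrimS (Iter⇒Eval it) ev

Eval⇒Iter : ∀ {n f g} {xs : Vec ℕ n} {k y} →
  Eval (prim f g) (k ∷ xs) y → Iter (Eval f xs) (λ k r r′ → Eval g (k ∷ r ∷ xs) r′) k y
Eval⇒Iter (evPrim0 ev)    = base ev
Eval⇒Iter (evPrimS ev ev′) = step (Eval⇒Iter ev) ev′

renTm : ∀ {m n} → (Fin n → Fin m) → Tm n → Tm m
renTm f (var i)  = var (f i)
renTm f 0'       = 0'
renTm f 1'       = 1'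
renTm f (t +' s) = renTm f t +' renTm f s
renTm f (t *' s) = renTm f t *' renTm f s

lift : ∀ {m n} → (Fin n → Fin m) → Fin (suc n) → Fin (suc m)
lift f fz     = fz
lift f (fs i) = fs (f i)

ren : ∀ {m n} → (Fin n → Fin m) → Fm n → Fm m
ren f (t ≐ s)  = renTm f t ≐ renTm f s
ren f (¬' φ)   = ¬' ren f φ
ren f (φ ∧' ψ) = ren f φ ∧' ren f ψ
ren f (∀' φ)   = ∀' ren (lift f) φ

-- Rosser's witness comparison, with the bound s itself as the compared witness.
before : ∀ {n} → BFm (1 + n) → BFm (2 + n) → Fm n
before φ ψ = ∃' (φ ⟨ v0 ⟩ ∧' ∀≤ v0 (¬' (ψ ⟨ v0 ⟩)))

numᵗ : ∀ {n} → ℕ → Tm n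
numᵗ zero    = 0'
numᵗ (suc k) = numᵗ k +' 1'

halting : PR 2 → BFm 3
halting e = ∃ᴮ (graph e (v3 ∷ v2 ∷ []) v0)

-- The arguments enter through equations, so that the matrix `halting e ⟨ v0 ⟩` is the same formula
-- that `unequalHalts` places in a larger context. Its variable `v0` is the bound on witnesses.
haltingSentence : PR 2 → ℕ → ℕ → Fm 0
haltingSentence e k l = ∃' ∃' ∃' (v2 ≐ numᵗ k ∧' v1 ≐ numᵗ l ∧' halting e ⟨ v0 ⟩)

haltingSentence-Σ₁ : ∀ e k l → Σ₁ (haltingSentence e k l)
haltingSentence-Σ₁ e k l =
  ex (ex (ex (δ (conj atom (conj atom (⟨⟩-Δ₀ (halting e) (graph-Δ₀ e (v3 ∷ v2 ∷ []) v0) v0))))))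

-- Models of arithmetic

-- Instantiated both at the quotient and at `ℕ-Str`, where it turns a true halting sentence into an
-- actual computation.
module Model (M : Str) (≈-equiv : IsEquivalence (Str._≈_ M))
  (⊕-resp : ∀ {a a′ b b′} → Str._≈_ M a a′ → Str._≈_ M b b′ → Str._≈_ M (Str._⊕_ M a b) (Str._⊕_ M a′ b′))
  (⊗-resp : ∀ {a a′ b b′} → Str._≈_ M a a′ → Str._≈_ M b b′ → Str._≈_ M (Str._⊗_ M a b) (Str._⊗_ M a′ b′))
  (pa : ModelPA M) where

  open Str M

  Env : ℕ → Set
  Env n = Fin n → Carrier

  infixr 5 _◂_
  _◂_ : ∀ {n} → Carrier → Env n → Env (suc n)
  a ◂ ρ = extend M a ρ

  val : ∀ {n} → Env n → Tm n → Carrier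
  val ρ t = ⟦_⟧ M t ρ

  ⌜_⌝ : ℕ → Carrier
  ⌜_⌝ = num M

  infix 4 _≋_ _⊩_
  _≋_ : Carrier → Carrier → Set
  a ≋ b = ¬ ¬ (a ≈ b)

  _⊩_ : ∀ {n} → Env n → Fm n → Set
  ρ ⊩ φ = Sat M φ ρ

  ≋-refl : ∀ {a} → a ≋ a
  ≋-refl k = k (IsEquivalence.refl ≈-equiv)

  ≋-reflexive : ∀ {a b} → a ≡ b → a ≋ b
  ≋-reflexive refl = ≋-refl

  ≋-sym : ∀ {a b} → a ≋ b → b ≋ a
  ≋-sym p k = p λ e → k (IsEquivalence.sym ≈-equiv e)

  infixr 5 _∙_
  _∙_ : ∀ {a b c} → a ≋ b → b ≋ c → a ≋ c
  (p ∙ q) k = p λ e → q λ e′ → k (IsEquivalence.trans ≈-equiv e e′)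

  ⊕-cong : ∀ {a a′ b b′} → a ≋ a′ → b ≋ b′ → a ⊕ b ≋ a′ ⊕ b′
  ⊕-cong p q k = p λ e → q λ e′ → k (⊕-resp e e′)

  ⊗-cong : ∀ {a a′ b b′} → a ≋ a′ → b ≋ b′ → a ⊗ b ≋ a′ ⊗ b′
  ⊗-cong p q k = p λ e → q λ e′ → k (⊗-resp e e′)

  -- Inherited from the doubly negated atoms; it permits classical reasoning whenever the goal is
  -- satisfaction in `M`.
  ⊩-stable : ∀ {n} (φ : Fm n) {ρ} → ¬ ¬ (ρ ⊩ φ) → ρ ⊩ φ
  ⊩-stable (_ ≐ _)  h = negated-stable h
  ⊩-stable (¬' _)   h = negated-stable h
  ⊩-stable (φ ∧' ψ) h = ⊩-stable φ (λ k → h (k ∘ proj₁)) , ⊩-stable ψ (λ k → h (k ∘ proj₂))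
  ⊩-stable (∀' φ)   h a = ⊩-stable φ λ k → h λ f → k (f a)

  val-wk : ∀ {n a} {ρ : Env n} (t : Tm n) → val (a ◂ ρ) (wk t) ≡ val ρ t
  val-wk (var _)  = refl
  val-wk 0'       = refl
  val-wk 1'       = refl
  val-wk (t +' s) = cong₂ _⊕_ (val-wk t) (val-wk s)
  val-wk (t *' s) = cong₂ _⊗_ (val-wk t) (val-wk s)

  val-cong : ∀ {n} {ρ σ : Env n} → (∀ i → ρ i ≋ σ i) → ∀ t → val ρ t ≋ val σ t
  val-cong h (var i)  = h i
  val-cong h 0'       = ≋-refl
  val-cong h 1'       = ≋-refl
  val-cong h (t +' s) = ⊕-cong (val-cong h t) (val-cong h s)
  val-cong h (t *' s) = ⊗-cong (val-cong h t) (val-cong h s)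

  ◂-cong : ∀ {n a b} {ρ σ : Env n} → a ≋ b → (∀ i → ρ i ≋ σ i) → ∀ i → (a ◂ ρ) i ≋ (b ◂ σ) i
  ◂-cong p h fz     = p
  ◂-cong p h (fs i) = h i

  ⊩-cong : ∀ {n} (φ : Fm n) {ρ σ} → (∀ i → ρ i ≋ σ i) → ρ ⊩ φ → σ ⊩ φ
  ⊩-cong (t ≐ s)  h p = ≋-sym (val-cong h t) ∙ p ∙ val-cong h s
  ⊩-cong (¬' φ)   h p = λ q → p (⊩-cong φ (λ i → ≋-sym (h i)) q)
  ⊩-cong (φ ∧' ψ) h (p , q) = ⊩-cong φ h p , ⊩-cong ψ h q
  ⊩-cong (∀' φ)   h p a = ⊩-cong φ (◂-cong ≋-refl h) (p a)

  ⊩-cong₀ : ∀ {n} (φ : Fm (suc n)) {ρ a b} → a ≋ b → a ◂ ρ ⊩ φ → b ◂ ρ ⊩ φ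
  ⊩-cong₀ φ p = ⊩-cong φ (◂-cong p λ _ → ≋-refl)

  -- Arithmetic in the model and its standard cut

  induction : ∀ {n} (φ : Fm (suc n)) (ρ : Env n) →
    𝟘 ◂ ρ ⊩ φ → (∀ a → a ◂ ρ ⊩ φ → a ⊕ 𝟙 ◂ ρ ⊩ φ) → ∀ a → a ◂ ρ ⊩ φ
  induction = proj₂ (proj₂ (proj₂ (proj₂ (proj₂ (proj₂ pa)))))

  suc≢0 : ∀ {a} → ¬ (a ⊕ 𝟙 ≋ 𝟘)
  suc≢0 {a} = proj₁ pa a

  suc-inj : ∀ {a b} → a ⊕ 𝟙 ≋ b ⊕ 𝟙 → a ≋ b
  suc-inj {a} {b} p k = proj₁ (proj₂ pa) a b (p , λ q → q k)

  ⊕-zeroʳ : ∀ a → a ⊕ 𝟘 ≋ a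
  ⊕-zeroʳ = proj₁ (proj₂ (proj₂ pa))

  ⊕-sucʳ : ∀ a b → a ⊕ (b ⊕ 𝟙) ≋ (a ⊕ b) ⊕ 𝟙
  ⊕-sucʳ = proj₁ (proj₂ (proj₂ (proj₂ pa)))

  ⊗-zeroʳ : ∀ a → a ⊗ 𝟘 ≋ 𝟘
  ⊗-zeroʳ = proj₁ (proj₂ (proj₂ (proj₂ (proj₂ pa))))

  ⊗-sucʳ : ∀ a b → a ⊗ (b ⊕ 𝟙) ≋ (a ⊗ b) ⊕ a
  ⊗-sucʳ = proj₁ (proj₂ (proj₂ (proj₂ (proj₂ (proj₂ pa)))))

  ⊕-zeroˡ : ∀ a → 𝟘 ⊕ a ≋ a
  ⊕-zeroˡ = induction (0' +' v0 ≐ v0) (ε M) (⊕-zeroʳ 𝟘) λ a ih → ⊕-sucʳ 𝟘 a ∙ ⊕-cong ih ≋-refl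

  ⊕-sucˡ : ∀ a b → (a ⊕ 𝟙) ⊕ b ≋ (a ⊕ b) ⊕ 𝟙
  ⊕-sucˡ a = induction ((v1 +' 1') +' v0 ≐ (v1 +' v0) +' 1') (a ◂ ε M)
    (⊕-zeroʳ (a ⊕ 𝟙) ∙ ⊕-cong (≋-sym (⊕-zeroʳ a)) ≋-refl)
    λ b ih → ⊕-sucʳ (a ⊕ 𝟙) b ∙ ⊕-cong (ih ∙ ≋-sym (⊕-sucʳ a b)) ≋-refl

  zero-or-suc : ∀ a → ¬ ¬ (a ≋ 𝟘 ⊎ Σ Carrier λ c → a ≋ c ⊕ 𝟙)
  zero-or-suc a k = induction (¬' (¬' (v0 ≐ 0') ∧' ∀' (¬' (v1 ≐ v0 +' 1')))) (ε M)
    (λ (n , _) → n ≋-refl) (λ c _ (_ , n) → n c ≋-refl) a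
    ((λ p → k (inj₁ p)) , (λ c p → k (inj₂ (c , p))))

  ⌜⌝-+ : ∀ m n → ⌜ m ⌝ ⊕ ⌜ n ⌝ ≋ ⌜ m + n ⌝
  ⌜⌝-+ m zero    = ⊕-zeroʳ ⌜ m ⌝ ∙ ≋-reflexive (cong ⌜_⌝ (sym (+-identityʳ m)))
  ⌜⌝-+ m (suc n) = ⊕-sucʳ ⌜ m ⌝ ⌜ n ⌝ ∙ ⊕-cong (⌜⌝-+ m n) ≋-refl ∙ ≋-reflexive (cong ⌜_⌝ (sym (+-suc m n)))

  ⌜⌝-* : ∀ m n → ⌜ m ⌝ ⊗ ⌜ n ⌝ ≋ ⌜ m * n ⌝
  ⌜⌝-* m zero    = ⊗-zeroʳ ⌜ m ⌝ ∙ ≋-reflexive (cong ⌜_⌝ (sym (*-zeroʳ m)))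
  ⌜⌝-* m (suc n) = ⊗-sucʳ ⌜ m ⌝ ⌜ n ⌝ ∙ ⊕-cong (⌜⌝-* m n) ≋-refl ∙ ⌜⌝-+ (m * n) m ∙
    ≋-reflexive (cong ⌜_⌝ (trans (+-comm (m * n) m) (sym (*-suc m n))))

  ⌜⌝-injective : ∀ m n → ⌜ m ⌝ ≋ ⌜ n ⌝ → m ≡ n
  ⌜⌝-injective zero    zero    _ = refl
  ⌜⌝-injective zero    (suc n) p = ⊥-elim (suc≢0 (≋-sym p))
  ⌜⌝-injective (suc m) zero    p = ⊥-elim (suc≢0 p)
  ⌜⌝-injective (suc m) (suc n) p = cong suc (⌜⌝-injective m n (suc-inj p))

  -- External induction on `n`: either the difference `c` is zero and `a` is `⌜ n ⌝`, or `c` is a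
  -- successor and one successor is cancelled on both sides.
  ≤⌜⌝⇒standard : ∀ n {a c} → a ⊕ c ≋ ⌜ n ⌝ → ¬ ¬ (Σ ℕ λ k → k ≤ n × a ≋ ⌜ k ⌝)
  ≤⌜⌝⇒standard n {a} {c} p k = zero-or-suc c λ
    { (inj₁ c≋0) → k (n , ≤-refl , ≋-sym (⊕-zeroʳ a) ∙ ⊕-cong ≋-refl (≋-sym c≋0) ∙ p)
    ; (inj₂ (c′ , c≋)) → predecessor n k (≋-sym (⊕-sucʳ a c′) ∙ ⊕-cong ≋-refl (≋-sym c≋) ∙ p) }
    where
    predecessor : ∀ n {c′} → ¬ (Σ ℕ λ k → k ≤ n × a ≋ ⌜ k ⌝) → ¬ ((a ⊕ c′) ⊕ 𝟙 ≋ ⌜ n ⌝)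
    predecessor zero    k q = suc≢0 q
    predecessor (suc n) k q = ≤⌜⌝⇒standard n (suc-inj q) λ (j , j≤n , e) → k (j , m≤n⇒m≤1+n j≤n , e)

  -- A zero difference would make `a` standard, so the difference is always a successor and can give
  -- up one more unit.
  nonstandard⇒≥⌜⌝ : ∀ {a} → (∀ n → ¬ (a ≋ ⌜ n ⌝)) → ∀ n → ¬ ¬ (Σ Carrier λ c → ⌜ n ⌝ ⊕ c ≋ a)
  nonstandard⇒≥⌜⌝ {a} ns zero    k = k (a , ⊕-zeroˡ a)
  nonstandard⇒≥⌜⌝ {a} ns (suc n) k = nonstandard⇒≥⌜⌝ ns n λ (c , p) → zero-or-suc c λ
    { (inj₁ c≋0) → ns n (≋-sym p ∙ ⊕-cong ≋-refl c≋0 ∙ ⊕-zeroʳ ⌜ n ⌝)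
    ; (inj₂ (c′ , c≋)) → k (c′ , ⊕-sucˡ ⌜ n ⌝ c′ ∙ ≋-sym (⊕-sucʳ ⌜ n ⌝ c′) ∙ ⊕-cong ≋-refl (≋-sym c≋) ∙ p) }

  val-wk² : ∀ {n a c} {ρ : Env n} (t : Tm n) → val (c ◂ a ◂ ρ) (wk (wk t)) ≋ val ρ t
  val-wk² t = ≋-reflexive (trans (val-wk (wk t)) (val-wk t))

  -- Bounded quantifiers in the model

  ∀≤-intro : ∀ {n} (t : Tm n) φ {ρ} →
    (∀ a c → a ⊕ c ≋ val ρ t → a ◂ ρ ⊩ φ) → ρ ⊩ ∀≤ t φ
  ∀≤-intro t φ h a (le , n) = le λ c p → n (h a c (p ∙ val-wk² t))

  ∀≤-elim : ∀ {n} (t : Tm n) φ {ρ} → ρ ⊩ ∀≤ t φ → ∀ a c → a ⊕ c ≋ val ρ t → a ◂ ρ ⊩ φ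
  ∀≤-elim t φ h a c p = ⊩-stable φ λ n → h a ((λ k → k c (p ∙ ≋-sym (val-wk² t))) , n)

  -- Below a standard bound there are only standard elements; this is the source of absoluteness for
  -- bounded formulas.
  ∀≤-intro-std : ∀ {N n} (t : Tm N) φ {ρ} → val ρ t ≋ ⌜ n ⌝ →
    (∀ k → k ≤ n → ⌜ k ⌝ ◂ ρ ⊩ φ) → ρ ⊩ ∀≤ t φ
  ∀≤-intro-std {n = n} t φ t↦ h = ∀≤-intro t φ λ a c p → ⊩-stable φ λ k →
    ≤⌜⌝⇒standard n (p ∙ t↦) λ (j , j≤n , e) → k (⊩-cong₀ φ (≋-sym e) (h j j≤n))

  ∀≤-elim-std : ∀ {N n} (t : Tm N) φ {ρ} → val ρ t ≋ ⌜ n ⌝ →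
    ρ ⊩ ∀≤ t φ → ∀ k → k ≤ n → ⌜ k ⌝ ◂ ρ ⊩ φ
  ∀≤-elim-std {n = n} t φ t↦ h k k≤n = ∀≤-elim t φ h ⌜ k ⌝ ⌜ n ∸ k ⌝
    (⌜⌝-+ k (n ∸ k) ∙ ≋-reflexive (cong ⌜_⌝ (m+[n∸m]≡n k≤n)) ∙ ≋-sym (t↦))

  ∃≤-intro-std : ∀ {N n} (t : Tm N) φ {ρ} → val ρ t ≋ ⌜ n ⌝ →
    ∀ k → k ≤ n → ⌜ k ⌝ ◂ ρ ⊩ φ → ρ ⊩ ∃≤ t φ
  ∃≤-intro-std t φ t↦ k k≤n p h = ∀≤-elim-std t (¬' φ) t↦ h k k≤n p

  ∃≤-elim-std : ∀ {N n} (t : Tm N) φ {ρ} → val ρ t ≋ ⌜ n ⌝ →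
    ρ ⊩ ∃≤ t φ → ¬ ¬ (Σ ℕ λ k → k ≤ n × ⌜ k ⌝ ◂ ρ ⊩ φ)
  ∃≤-elim-std t φ t↦ h ¬ex = h (∀≤-intro-std t (¬' φ) t↦ λ k k≤n p → ¬ex (k , k≤n , p))

  -- Families of environments: in a witness comparison the environment contains the possibly
  -- nonstandard bound, on which the threshold in Enumerates must not depend.
  infixr 5 _◃_ _◅_
  data Envs (I : Set) : ℕ → Set where
    env : ∀ {n} → (I → Env n) → Envs I n
    _◃_ : ∀ {n} → ℕ → Envs I n → Envs I (suc n)
    _◅_ : ∀ {n} → (I → Carrier) → Envs I n → Envs I (suc n)

  infix 6 _⊙_
  _⊙_ : ∀ {I n} → Envs I n → I → Env n
  env ρ   ⊙ i = ρ i
  (k ◃ ρ) ⊙ i = ⌜ k ⌝ ◂ ρ ⊙ i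
  (a ◅ ρ) ⊙ i = a i ◂ ρ ⊙ i

  infix 4 _⊢_↦_
  record _⊢_↦_ {I n} (ρ : Envs I n) (t : Tm n) (k : ℕ) : Set where
    constructor std
    field val≋ : ∀ i → val (ρ ⊙ i) t ≋ ⌜ k ⌝

  open _⊢_↦_ public

  module _ {I : Set} {n : ℕ} {ρ : Envs I n} where

    ↦0 : ρ ⊢ 0' ↦ 0
    ↦0 = std λ _ → ≋-refl

    ↦1 : ρ ⊢ 1' ↦ 1
    ↦1 = std λ _ → ≋-sym (⊕-zeroˡ 𝟙)

    ↦+ : ∀ {t s k l} → ρ ⊢ t ↦ k → ρ ⊢ s ↦ l → ρ ⊢ t +' s ↦ k + l
    ↦+ {k = k} {l} (std p) (std q) = std λ i → ⊕-cong (p i) (q i) ∙ ⌜⌝-+ k l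

    ↦* : ∀ {t s k l} → ρ ⊢ t ↦ k → ρ ⊢ s ↦ l → ρ ⊢ t *' s ↦ k * l
    ↦* {k = k} {l} (std p) (std q) = std λ i → ⊗-cong (p i) (q i) ∙ ⌜⌝-* k l

    ↦suc : ∀ {t k} → ρ ⊢ t ↦ k → ρ ⊢ t +' 1' ↦ suc k
    ↦suc (std p) = std λ i → ⊕-cong (p i) ≋-refl

    ↦π : ∀ {t s k l} → ρ ⊢ t ↦ k → ρ ⊢ s ↦ l → ρ ⊢ πᵗ t s ↦ π k l
    ↦π p q = ↦+ (↦* (↦+ p q) (↦+ p q)) p

    ↦v0 : ∀ {k} → k ◃ ρ ⊢ v0 ↦ k
    ↦v0 = std λ _ → ≋-refl

    ↦wk : ∀ {t k l} → ρ ⊢ t ↦ k → l ◃ ρ ⊢ wk t ↦ k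
    ↦wk {t} (std p) = std λ i → ≋-reflexive (val-wk t) ∙ p i

  module _ {I : Set} {n k₀ k₁ : ℕ} {ρ : Envs I n} where

    ↦v1 : k₀ ◃ k₁ ◃ ρ ⊢ v1 ↦ k₁
    ↦v1 = std λ _ → ≋-refl

    module _ {k₂ : ℕ} where

      ↦v2 : k₀ ◃ k₁ ◃ k₂ ◃ ρ ⊢ v2 ↦ k₂
      ↦v2 = std λ _ → ≋-refl

      module _ {k₃ : ℕ} where

        ↦v3 : k₀ ◃ k₁ ◃ k₂ ◃ k₃ ◃ ρ ⊢ v3 ↦ k₃
        ↦v3 = std λ _ → ≋-refl

        module _ {k₄ : ℕ} where

          ↦v4 : k₀ ◃ k₁ ◃ k₂ ◃ k₃ ◃ k₄ ◃ ρ ⊢ v4 ↦ k₄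
          ↦v4 = std λ _ → ≋-refl

          ↦v5 : ∀ {k₅} → k₀ ◃ k₁ ◃ k₂ ◃ k₃ ◃ k₄ ◃ k₅ ◃ ρ ⊢ v5 ↦ k₅
          ↦v5 = std λ _ → ≋-refl

          ↦v6 : ∀ {k₅ k₆} → k₀ ◃ k₁ ◃ k₂ ◃ k₃ ◃ k₄ ◃ k₅ ◃ k₆ ◃ ρ ⊢ v6 ↦ k₆
          ↦v6 = std λ _ → ≋-refl

  -- Absoluteness: external relations defined or enumerated by formulas

  module _ {I : Set} {n : ℕ} {ρ : Envs I n} where

    record Defines (φ : Fm n) (R : Set) : Set where
      constructor mkDefines
      field
        sound    : ∀ i → ρ ⊙ i ⊩ φ → ¬ ¬ R
        complete : R → ∀ i → ρ ⊙ i ⊩ φ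

    -- Only standard values of the bound `s` are constrained, since a nonstandard bound could admit
    -- spurious witnesses. Satisfaction has to persist beyond a threshold so that the thresholds of
    -- several subformulas combine by maximum.
    record Enumerates (φ : BFm n) (R : Set) : Set where
      constructor mkEnumerates
      field
        sound    : ∀ i s k → val (ρ ⊙ i) s ≋ ⌜ k ⌝ → ρ ⊙ i ⊩ φ ⟨ s ⟩ → ¬ ¬ R
        complete : R → ¬ ¬ (Σ ℕ λ k₀ → ∀ i s k → val (ρ ⊙ i) s ≋ ⌜ k ⌝ → k₀ ≤ k → ρ ⊙ i ⊩ φ ⟨ s ⟩)

  infix 4 _⊢_defines_ _⊢_enumerates_
  _⊢_defines_ : ∀ {I n} → Envs I n → Fm n → Set → Set
  ρ ⊢ φ defines R = Defines {ρ = ρ} φ R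

  _⊢_enumerates_ : ∀ {I n} → Envs I n → BFm n → Set → Set
  ρ ⊢ φ enumerates R = Enumerates {ρ = ρ} φ R

  module D = Defines
  module En = Enumerates

  val-wk≋ : ∀ {n a c} {ρ : Env n} (t : Tm n) → val ρ t ≋ c → val (a ◂ ρ) (wk t) ≋ c
  val-wk≋ t p = ≋-reflexive (val-wk t) ∙ p

  module _ {I : Set} {n : ℕ} {ρ : Envs I n} where

    def-≐ : ∀ {t s k l} → ρ ⊢ t ↦ k → ρ ⊢ s ↦ l → ρ ⊢ t ≐ s defines (k ≡ l)
    def-≐ (std p) (std q) = mkDefines (λ i e k → k (⌜⌝-injective _ _ (≋-sym (p i) ∙ e ∙ q i)))
      λ { refl i → p i ∙ ≋-sym (q i) }

    def-¬ : ∀ {φ R} → ρ ⊢ φ defines R → ρ ⊢ ¬' φ defines (¬ R)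
    def-¬ d = mkDefines (λ i n k → k λ r → n (D.complete d r i)) λ ¬r i p → D.sound d i p ¬r

    def-∧ : ∀ {φ ψ R Q} → ρ ⊢ φ defines R → ρ ⊢ ψ defines Q → ρ ⊢ φ ∧' ψ defines (R × Q)
    def-∧ d e = mkDefines
      (λ i (p , q) → ¬¬-bind (D.sound d i p) λ r → ¬¬-bind (D.sound e i q) λ r′ k → k (r , r′))
      λ (r , q) i → D.complete d r i , D.complete e q i

    def-∀≤ : ∀ t φ {m} {R : ℕ → Set} → ρ ⊢ t ↦ m →
      (∀ k → k ◃ ρ ⊢ φ defines R k) → ρ ⊢ ∀≤ t φ defines (∀ k → k ≤ m → R k)
    def-∀≤ t φ {m} (std t↦) d = mkDefines
      (λ i h → ¬¬-∀≤ m λ k k≤m → D.sound (d k) i (∀≤-elim-std t φ (t↦ i) h k k≤m))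
      λ r i → ∀≤-intro-std t φ (t↦ i) λ k k≤m → D.complete (d k) (r k k≤m) i

    def-∃≤ : ∀ t φ {m} {R : ℕ → Set} → ρ ⊢ t ↦ m →
      (∀ k → k ◃ ρ ⊢ φ defines R k) → ρ ⊢ ∃≤ t φ defines (Σ ℕ λ k → k ≤ m × R k)
    def-∃≤ t φ (std t↦) d = mkDefines
      (λ i h → ¬¬-bind (∃≤-elim-std t φ (t↦ i) h) λ (k , k≤m , p) →
        ¬¬-bind (D.sound (d k) i p) λ r c → c (k , k≤m , r))
      λ (k , k≤m , r) i → ∃≤-intro-std t φ (t↦ i) k k≤m (D.complete (d k) r i)

    def-map : ∀ {φ R Q} → (R → Q) → (Q → R) → ρ ⊢ φ defines R → ρ ⊢ φ defines Q
    def-map f g d = mkDefines (λ i p → ¬¬-map f (D.sound d i p)) (D.complete d ∘ g)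

    en-¬¬map : ∀ {φ R Q} → (R → ¬ ¬ Q) → (Q → R) → ρ ⊢ φ enumerates R → ρ ⊢ φ enumerates Q
    en-¬¬map f g d = mkEnumerates (λ i s k s↦ p → ¬¬-bind (En.sound d i s k s↦ p) f) (En.complete d ∘ g)

    en-map : ∀ {φ R Q} → (R → Q) → (Q → R) → ρ ⊢ φ enumerates R → ρ ⊢ φ enumerates Q
    en-map f g d = en-¬¬map (λ r k → k (f r)) g d

    en-const : ∀ {φ R} → ρ ⊢ φ defines R → ρ ⊢ constᴮ φ enumerates R
    en-const d = mkEnumerates (λ i _ _ _ → D.sound d i) λ r k → k (0 , λ i _ _ _ _ → D.complete d r i)

    en-∧ : ∀ {φ ψ R Q} → ρ ⊢ φ enumerates R → ρ ⊢ ψ enumerates Q → ρ ⊢ φ ∧ᴮ ψ enumerates (R × Q)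
    en-∧ d e = mkEnumerates
      (λ i s k s↦ (p , q) → ¬¬-bind (En.sound d i s k s↦ p) λ r →
        ¬¬-bind (En.sound e i s k s↦ q) λ r′ c → c (r , r′))
      λ (r , q) → ¬¬-bind (En.complete d r) λ (j , f) → ¬¬-bind (En.complete e q) λ (l , g) c →
        c (j ⊔ l , λ i s k s↦ le → f i s k s↦ (m⊔n≤o⇒m≤o j l le) , g i s k s↦ (m⊔n≤o⇒n≤o j l le))

    en-∨ : ∀ {φ ψ R Q} → ρ ⊢ φ enumerates R → ρ ⊢ ψ enumerates Q → ρ ⊢ φ ∨ᴮ ψ enumerates (R ⊎ Q)
    en-∨ d e = mkEnumerates
      (λ i s k s↦ h c → h ( (λ p → En.sound d i s k s↦ p (c ∘ inj₁))
                          , (λ q → En.sound e i s k s↦ q (c ∘ inj₂))))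
      [ (λ r → ¬¬-map (map₂ λ f i s k s↦ le (n , _) → n (f i s k s↦ le)) (En.complete d r))
      , (λ q → ¬¬-map (map₂ λ g i s k s↦ le (_ , n) → n (g i s k s↦ le)) (En.complete e q)) ]

    en-∃ : ∀ {φ} {R : ℕ → Set} → (∀ k → k ◃ ρ ⊢ φ enumerates R k) → ρ ⊢ ∃ᴮ φ enumerates Σ ℕ R
    en-∃ {φ} d = mkEnumerates
      (λ i s m s↦ h → ¬¬-bind (∃≤-elim-std {n = m} s (φ ⟨ wk s ⟩) s↦ h) λ (k , _ , p) →
        ¬¬-map (k ,_) (En.sound (d k) i (wk s) m (val-wk≋ s s↦) p))
      -- The bound must reach the witness `k` itself as well as the threshold `j` of the matrix.
      λ (k , r) → ¬¬-bind (En.complete (d k) r) λ (j , f) c → c (j ⊔ k , λ i s m s↦ le →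
        ∃≤-intro-std {n = m} s (φ ⟨ wk s ⟩) s↦ k (m⊔n≤o⇒n≤o j k le)
          (f i (wk s) m (val-wk≋ s s↦) (m⊔n≤o⇒m≤o j k le)))

    en-∃≤ : ∀ {t φ m} {R : ℕ → Set} → ρ ⊢ t ↦ m →
      (∀ k → k ◃ ρ ⊢ φ enumerates R k) → ρ ⊢ ∃≤ᴮ t φ enumerates (Σ ℕ λ k → k ≤ m × R k)
    en-∃≤ {t} {φ} (std t↦) d = mkEnumerates
      (λ i s m s↦ h → ¬¬-bind (∃≤-elim-std t (φ ⟨ wk s ⟩) (t↦ i) h) λ (k , k≤ , p) →
        ¬¬-map (λ r → k , k≤ , r) (En.sound (d k) i (wk s) m (val-wk≋ s s↦) p))
      λ (k , k≤ , r) → ¬¬-map (map₂ λ f i s m s↦ le →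
        ∃≤-intro-std t (φ ⟨ wk s ⟩) (t↦ i) k k≤ (f i (wk s) m (val-wk≋ s s↦) le)) (En.complete (d k) r)

    en-∀≤ : ∀ {t φ m} {R : ℕ → Set} → ρ ⊢ t ↦ m →
      (∀ k → k ◃ ρ ⊢ φ enumerates R k) → ρ ⊢ ∀≤ᴮ t φ enumerates (∀ k → k ≤ m → R k)
    en-∀≤ {t} {φ} {m} (std t↦) d = mkEnumerates
      (λ i s l s↦ h → ¬¬-∀≤ m λ k k≤m →
        En.sound (d k) i (wk s) l (val-wk≋ s s↦) (∀≤-elim-std t (φ ⟨ wk s ⟩) (t↦ i) h k k≤m))
      λ r → ¬¬-bind (¬¬-∀≤ m λ k k≤m → En.complete (d k) (r k k≤m)) λ h c →
        let (j , f) = uniform-threshold m {λ k l → ∀ i s → val (⌜ k ⌝ ◂ ρ ⊙ i) s ≋ ⌜ l ⌝ → ⌜ k ⌝ ◂ ρ ⊙ i ⊩ φ ⟨ s ⟩}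
                        (λ k k≤m → proj₁ (h k k≤m) , λ l le i s s↦ → proj₂ (h k k≤m) i s l s↦ le)
        in c (j , λ i s l s↦ le →
             ∀≤-intro-std t (φ ⟨ wk s ⟩) (t↦ i) λ k k≤m → f k k≤m l le i (wk s) (val-wk≋ s s↦))

  infixr 5 _◃*_
  _◃*_ : ∀ {I n m} → Vec ℕ m → Envs I n → Envs I (m + n)
  []       ◃* ρ = ρ
  (k ∷ ks) ◃* ρ = k ◃ (ks ◃* ρ)

  infix 4 _⊢_↦*_
  _⊢_↦*_ : ∀ {I n m} → Envs I n → Vec (Tm n) m → Vec ℕ m → Set
  ρ ⊢ ts ↦* ks = Pointwise (ρ ⊢_↦_) ts ks

  module _ {I : Set} {n : ℕ} {ρ : Envs I n} where

    ↦wks : ∀ {m} (ks : Vec ℕ m) {t k} → ρ ⊢ t ↦ k → ks ◃* ρ ⊢ wks m t ↦ k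
    ↦wks []       p = p
    ↦wks (_ ∷ ks) p = ↦wk (↦wks ks p)

    ↦*-wks : ∀ {m} (ks : Vec ℕ m) {l} {ts : Vec _ l} {xs} → ρ ⊢ ts ↦* xs → ks ◃* ρ ⊢ map (wks m) ts ↦* xs
    ↦*-wks ks []       = []
    ↦*-wks ks (p ∷ ps) = ↦wks ks p ∷ ↦*-wks ks ps

  ↦*-wk : ∀ {I n k} {ρ : Envs I n} {m} {ts : Vec _ m} {xs} → ρ ⊢ ts ↦* xs → k ◃ ρ ⊢ map wk ts ↦* xs
  ↦*-wk {k = k} = ↦*-wks (k ∷ [])

  ↦vars : ∀ {I n m} {ρ : Envs I n} (ks : Vec ℕ m) → ks ◃* ρ ⊢ vars m ↦* ks
  ↦vars []       = []
  ↦vars (k ∷ ks) = ↦v0 ∷ ↦*-wk (↦vars ks)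

  en-∃* : ∀ {I n} {ρ : Envs I n} m {φ} {R : Vec ℕ m → Set} →
    (∀ ks → ks ◃* ρ ⊢ φ enumerates R ks) → ρ ⊢ ∃ᴮ* m φ enumerates Σ (Vec ℕ m) R
  en-∃* zero    d = en-map ([] ,_) (λ { ([] , r) → r }) (d [])
  en-∃* (suc m) d = en-map (λ (ks , k , r) → k ∷ ks , r) (λ { (k ∷ ks , r) → ks , k , r })
    (en-∃* m λ ks → en-∃ λ k → d (k ∷ ks))

  def-member : ∀ {I n} {ρ : Envs I n} {x m b i k l} → ρ ⊢ x ↦ i → ρ ⊢ m ↦ k → ρ ⊢ b ↦ l →
    ρ ⊢ member x m b defines Member i k l
  def-member {b = b} {i} {k} x↦ m↦ b↦ = def-map
    (λ (c , _ , eq) → c , eq)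
    -- The modulus is positive, so the quotient is at most `b` and the bounded search finds it.
    (λ (c , eq) → c , ≤-trans (m≤n*m c (modulus k i)) (≤-reflexive eq) , eq)
    (def-∃≤ b _ b↦ λ c → def-≐ (↦* (↦+ ↦1 (↦* (↦+ (↦wk x↦) ↦1) (↦wk m↦))) ↦v0) (↦wk b↦))

  en-iter : ∀ {I N} {ρ : Envs I N} {φ ψ n y k l} {F : ℕ → Set} {G : ℕ → ℕ → ℕ → Set} →
    ρ ⊢ n ↦ k → ρ ⊢ y ↦ l →
    (∀ (ks : Vec ℕ 4) → ks ◃* ρ ⊢ φ enumerates F (lookup ks fz)) →
    (∀ (ks : Vec ℕ 6) → ks ◃* ρ ⊢ ψ enumerates
      G (lookup ks (fs (fs fz))) (lookup ks (fs fz)) (lookup ks fz)) →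
    ρ ⊢ iterᴮ φ ψ n y enumerates Iter F G k l
  en-iter {k = k₁} {l} {F} {G} n↦ y↦ f g = en-map
    (λ { (c ∷ b ∷ m ∷ [] , code) → IsIterCode⇒Iter m b c code })
    (λ it → let (m , b , c , code) = Iter⇒IsIterCode it in c ∷ b ∷ m ∷ [] , code)
    (en-∃* 3 {R = λ ks → IsIterCode {F} {G} k₁ l (lookup ks (fs (fs fz))) (lookup ks (fs fz)) (lookup ks fz)} λ { ks@(c ∷ b ∷ m ∷ []) →
      en-∧ (en-∃≤ ↦v0 λ y₀ → en-∧ (f (y₀ ∷ ks))
             (en-const (def-member (↦π ↦0 ↦v0) ↦v3 ↦v2)))
     (en-∧ (en-∀≤ (↦wks ks n↦) λ k → en-∨ (en-const (def-≐ ↦v0 (↦wks (k ∷ ks) n↦)))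
             (en-∀≤ ↦v1 λ r → en-∨ (en-const (def-¬ (def-member (↦π ↦v1 ↦v0) ↦v4 ↦v3)))
               (en-∃≤ ↦v2 λ r′ → en-∧ (g (r′ ∷ r ∷ k ∷ ks))
                 (en-const (def-member (↦π (↦suc ↦v2) ↦v0) ↦v5 ↦v4)))))
           (en-∀≤ ↦v0 λ r → en-∨
             (en-const (def-¬ (def-member (↦π (↦wks (r ∷ ks) n↦) ↦v0) ↦v3 ↦v2)))
             (en-const (def-≐ ↦v0 (↦wks (r ∷ ks) y↦))))) })

  def-prime : ∀ {I n} {ρ : Envs I n} {x k} → ρ ⊢ x ↦ k → ρ ⊢ primeᶠ x defines IsPrime k
  def-prime {x = x} x↦ = def-∧ (def-∧ (def-¬ (def-≐ x↦ ↦0)) (def-¬ (def-≐ x↦ ↦1)))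
    (def-∀≤ x _ x↦ λ a → def-∀≤ (wk x) _ (↦wk x↦) λ b →
      def-¬ (def-≐ (↦* (↦suc (↦suc ↦v1)) (↦suc (↦suc ↦v0))) (↦wk (↦wk x↦))))

  en-primeCount : ∀ {I n} {ρ : Envs I n} {x y k l} → ρ ⊢ x ↦ k → ρ ⊢ y ↦ l →
    ρ ⊢ primeCountᴮ x y enumerates Iter (_≡ 0) CountStep k l
  en-primeCount x↦ y↦ = en-iter x↦ y↦
    (λ { (y ∷ _) → en-const (def-≐ ↦v0 ↦0) })
    (λ { (r′ ∷ r ∷ k ∷ _) → en-∨
      (en-∧ (en-const (def-prime ↦v2)) (en-const (def-≐ ↦v0 (↦suc ↦v1))))
      (en-∧ (en-const (def-¬ (def-prime ↦v2))) (en-const (def-≐ ↦v0 ↦v1))) })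

  mutual
    en-graph : ∀ {I N n} {ρ : Envs I N} (e : PR n) {ts xs t y} →
      ρ ⊢ ts ↦* xs → ρ ⊢ t ↦ y → ρ ⊢ graph e ts t enumerates Eval e xs y
    en-graph Z [] y↦ = en-const (def-map (λ { refl → evZ }) (λ { evZ → refl }) (def-≐ y↦ ↦0))
    en-graph S (x↦ ∷ []) y↦ =
      en-const (def-map (λ { refl → evS }) (λ { evS → refl }) (def-≐ y↦ (↦suc x↦)))
    en-graph (proj i) xs↦ y↦ =
      en-const (def-map (λ { refl → evProj }) (λ { evProj → refl }) (def-≐ y↦ (Pointwise.lookup xs↦ i)))
    en-graph (comp {m} f gs) xs↦ y↦ = en-map
      (λ (ys , evs , ev) → evComp evs ev) (λ { (evComp {ys = ys} evs ev) → ys , evs , ev })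
      (en-∃* m λ ys → en-∧ (en-graphs gs (↦*-wks ys xs↦) (↦vars ys)) (en-graph f (↦vars ys) (↦wks ys y↦)))
    en-graph (prim f g) (n↦ ∷ xs↦) y↦ = en-map Iter⇒Eval Eval⇒Iter (en-iter n↦ y↦
      (λ { ks@(_ ∷ _) → en-graph f (↦*-wks ks xs↦) ↦v0 })
      (λ { ks@(_ ∷ _ ∷ _ ∷ _) → en-graph g (↦v2 ∷ ↦v1 ∷ ↦*-wks ks xs↦) ↦v0 }))
    en-graph (mu f) xs↦ y↦ = en-map
      (λ (ev , below) → evMu ev λ z z<y → [ (λ z≡y → contradiction z≡y (<⇒≢ z<y)) , id ] (below z (<⇒≤ z<y)))
      (λ { (evMu ev below) → ev , λ z z≤y → [ inj₂ ∘ below z , inj₁ ] (m≤n⇒m<n∨m≡n z≤y) })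
      (en-∧ (en-graph f (y↦ ∷ xs↦) ↦0)
            (en-∀≤ y↦ λ z → en-∨ (en-const (def-≐ ↦v0 (↦wk y↦)))
              (en-∃ λ k → en-graph f (↦v1 ∷ ↦*-wks (k ∷ z ∷ []) xs↦) (↦suc ↦v0))))

    en-graphs : ∀ {I N n m} {ρ : Envs I N} (gs : Vec (PR n) m) {ts xs us ys} →
      ρ ⊢ ts ↦* xs → ρ ⊢ us ↦* ys → ρ ⊢ graphs gs ts us enumerates EvalV gs xs ys
    en-graphs []       xs↦ []         = en-const (def-map (λ _ → []) (λ _ → refl) (def-≐ ↦0 ↦0))
    en-graphs (g ∷ gs) xs↦ (y↦ ∷ ys↦) =
      en-map (λ (ev , evs) → ev ∷ evs) (λ { (ev ∷ evs) → ev , evs })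
        (en-∧ (en-graph g xs↦ y↦) (en-graphs gs xs↦ ys↦))

  -- Weakening and renaming of variables

  val-wks : ∀ {I n m} {ρ : Envs I n} (ks : Vec ℕ m) {i} t → val ((ks ◃* ρ) ⊙ i) (wks m t) ≡ val (ρ ⊙ i) t
  val-wks         []       t = refl
  val-wks {m = suc m} (_ ∷ ks) t = trans (val-wk (wks m t)) (val-wks ks t)

  val-ren : ∀ {m n} {f : Fin n → Fin m} {ρ σ} → (∀ i → ρ (f i) ≡ σ i) → ∀ t → val ρ (renTm f t) ≡ val σ t
  val-ren h (var i)  = h i
  val-ren h 0'       = refl
  val-ren h 1'       = refl
  val-ren h (t +' s) = cong₂ _⊕_ (val-ren h t) (val-ren h s)
  val-ren h (t *' s) = cong₂ _⊗_ (val-ren h t) (val-ren h s)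

  lift-extends : ∀ {m n} {f : Fin n → Fin m} {ρ σ a} →
    (∀ i → ρ (f i) ≡ σ i) → ∀ i → (a ◂ ρ) (lift f i) ≡ (a ◂ σ) i
  lift-extends h fz     = refl
  lift-extends h (fs i) = h i

  mutual
    ⊩-ren : ∀ {m n} (φ : Fm n) {f : Fin n → Fin m} {ρ σ} → (∀ i → ρ (f i) ≡ σ i) → ρ ⊩ ren f φ → σ ⊩ φ
    ⊩-ren (t ≐ s)  h p = ≋-reflexive (sym (val-ren h t)) ∙ p ∙ ≋-reflexive (val-ren h s)
    ⊩-ren (¬' φ)   h p = λ q → p (ren-⊩ φ h q)
    ⊩-ren (φ ∧' ψ) h (p , q) = ⊩-ren φ h p , ⊩-ren ψ h q
    ⊩-ren (∀' φ)   h p a = ⊩-ren φ (lift-extends h) (p a)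

    ren-⊩ : ∀ {m n} (φ : Fm n) {f : Fin n → Fin m} {ρ σ} → (∀ i → ρ (f i) ≡ σ i) → σ ⊩ φ → ρ ⊩ ren f φ
    ren-⊩ (t ≐ s)  h p = ≋-reflexive (val-ren h t) ∙ p ∙ ≋-reflexive (sym (val-ren h s))
    ren-⊩ (¬' φ)   h p = λ q → p (⊩-ren φ h q)
    ren-⊩ (φ ∧' ψ) h (p , q) = ren-⊩ φ h p , ren-⊩ ψ h q
    ren-⊩ (∀' φ)   h p a = ren-⊩ φ (lift-extends h) (p a)

  -- Witness comparison and overspill

  module _ {n} {ρ : Env n} {φ ψ R Q}
    (φ-enum : id ◅ env (λ _ → ρ) ⊢ φ enumerates R)
    (ψ-enum : proj₁ ◅ proj₂ ◅ env (λ _ → ρ) ⊢ ψ enumerates Q) where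

    -- The threshold of `φ` is the witness: all bounds up to it are standard, and at a standard
    -- bound `ψ` would yield `Q`.
    before-intro : R → ¬ Q → ρ ⊩ before φ ψ
    before-intro r ¬q none = En.complete φ-enum r λ (k , f) → none ⌜ k ⌝
      ( f ⌜ k ⌝ v0 k ≋-refl ≤-refl
      , ∀≤-intro-std {n = k} v0 (¬' (ψ ⟨ v0 ⟩)) ≋-refl λ j _ p →
          En.sound ψ-enum (⌜ j ⌝ , ⌜ k ⌝) v0 j ≋-refl p ¬q )

    -- A bound `a` satisfying `φ` must be nonstandard, since otherwise `R` would follow. It
    -- therefore exceeds the standard threshold of `ψ`, where `ψ` holds against the comparison.
    before-elim : ¬ R → Q → ¬ (ρ ⊩ before φ ψ)
    before-elim ¬r q h = h λ a (p , smaller) → En.complete ψ-enum q λ (k , f) →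
      nonstandard⇒≥⌜⌝ (λ n a≋n → En.sound φ-enum a v0 n a≋n p ¬r) k λ (c , k≤a) →
      ∀≤-elim v0 (¬' (ψ ⟨ v0 ⟩)) smaller ⌜ k ⌝ c k≤a (f (⌜ k ⌝ , a) v0 k ≋-refl ≤-refl)

  overspill : Nonstandard M → ∀ {n} (φ : Fm (suc n)) ρ → (∀ n → ⌜ n ⌝ ◂ ρ ⊩ φ) →
    ¬ ¬ (Σ Carrier λ a → (∀ n → ¬ (a ≋ ⌜ n ⌝)) × a ◂ ρ ⊩ φ)
  overspill nonstd φ ρ h none = nonstd λ a ns → none (a , (λ n p → p (ns n)) , everywhere a)
    where
    -- Otherwise φ would define the standard cut.
    everywhere : ∀ a → a ◂ ρ ⊩ φ
    everywhere = induction φ ρ (h 0) λ a p → ⊩-stable φ λ ¬p →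
      none (a , (λ n a≋n → ¬p (⊩-cong₀ φ (⊕-cong (≋-sym a≋n) ≋-refl) (h (suc n)))) , p)

  ∃≤-elim : ∀ {n} (t : Tm n) φ {ρ} → ρ ⊩ ∃≤ t φ →
    ¬ ¬ (Σ Carrier λ a → Σ Carrier λ c → a ⊕ c ≋ val ρ t × a ◂ ρ ⊩ φ)
  ∃≤-elim t φ h none = h (∀≤-intro t (¬' φ) λ a c p q → none (a , c , p , q))

  ∃≤-intro : ∀ {n} (t : Tm n) φ {ρ} a c → a ⊕ c ≋ val ρ t → a ◂ ρ ⊩ φ → ρ ⊩ ∃≤ t φ
  ∃≤-intro t φ a c p q h = ∀≤-elim t (¬' φ) h a c p q

  val-numᵗ : ∀ {n} {ρ : Env n} k → val ρ (numᵗ k) ≡ ⌜ k ⌝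
  val-numᵗ zero    = refl
  val-numᵗ (suc k) = cong (λ a → a ⊕ 𝟙) (val-numᵗ k)

  en-halting : ∀ {I} {ρ : Envs I 3} {e k l} → ρ ⊢ v2 ↦ k → ρ ⊢ v1 ↦ l →
    ρ ⊢ halting e enumerates Halts e (k ∷ l ∷ [])
  en-halting {e = e} k↦ l↦ = en-∃ λ v → en-graph e (↦wk k↦ ∷ ↦wk l↦ ∷ []) ↦v0

-- The diagonal argument

mutual
  Eval-deterministic : ∀ {n} {e : PR n} {xs y y′} → Eval e xs y → Eval e xs y′ → y ≡ y′
  Eval-deterministic evZ evZ = refl
  Eval-deterministic evS evS = refl
  Eval-deterministic evProj evProj = refl
  Eval-deterministic (evComp evs ev) (evComp evs′ ev′) with refl ← EvalV-deterministic evs evs′ =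
    Eval-deterministic ev ev′
  Eval-deterministic (evPrim0 ev) (evPrim0 ev′) = Eval-deterministic ev ev′
  Eval-deterministic (evPrimS ev₁ ev) (evPrimS ev₁′ ev′) with refl ← Eval-deterministic ev₁ ev₁′ =
    Eval-deterministic ev ev′
  Eval-deterministic (evMu {y = y} ev below) (evMu {y = y′} ev′ below′) with <-cmp y y′
  ... | tri< y<y′ _ _ = contradiction (Eval-deterministic ev (proj₂ (below′ y y<y′))) λ ()
  ... | tri≈ _ y≡y′ _ = y≡y′
  ... | tri> _ _ y′<y = contradiction (Eval-deterministic (proj₂ (below y′ y′<y)) ev′) λ ()

  EvalV-deterministic : ∀ {m n} {gs : Vec (PR n) m} {xs ys ys′} → EvalV gs xs ys → EvalV gs xs ys′ → ys ≡ ys′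
  EvalV-deterministic [] [] = refl
  EvalV-deterministic (ev ∷ evs) (ev′ ∷ evs′) =
    cong₂ _∷_ (Eval-deterministic ev ev′) (EvalV-deterministic evs evs′)

constant : ∀ {n} → ℕ → PR n
constant zero    = comp Z []
constant (suc k) = comp S (constant k ∷ [])

Eval-constant : ∀ {n} k {xs : Vec ℕ n} → Eval (constant k) xs k
Eval-constant zero    = evComp [] evZ
Eval-constant (suc k) = evComp (Eval-constant k ∷ []) evS

module Diagonal (_⊕_ _⊗_ : ℕ → ℕ → ℕ) (E : ℕ → ℕ → Set)
  (⊕-computable : Computable₂ _⊕_) (⊗-computable : Computable₂ _⊗_)
  (E-equiv : IsEquivalence E) (E-congruence : Congruence₂ E _⊕_ _⊗_) (z o : ℕ)
  (pa : ModelPA (Quotient _⊕_ _⊗_ E z o)) (nonstandard : Nonstandard (Quotient _⊕_ _⊗_ E z o)) where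

  M : Str
  M = Quotient _⊕_ _⊗_ E z o

  open Model M E-equiv (proj₁ E-congruence) (proj₂ E-congruence) pa

  plus times : PR 2
  plus  = proj₁ ⊕-computable
  times = proj₁ ⊗-computable

  -- In the quotient the element `⌜ i ⌝` is itself a natural number, in general different from `i`,
  -- and it is computed from `i` by iterated addition of `o`.
  numeral : PR 1
  numeral = prim (constant z) (comp plus (proj (fs fz) ∷ constant o ∷ []))

  Eval-numeral : ∀ i → Eval numeral (i ∷ []) ⌜ i ⌝
  Eval-numeral zero    = evPrim0 (Eval-constant z)
  Eval-numeral (suc i) = evPrimS (Eval-numeral i)
    (evComp (evProj ∷ Eval-constant o ∷ []) (proj₂ ⊕-computable ⌜ i ⌝ o))

  -- The left-hand side of `memberVia` at the standard element `⌜ i ⌝`, evaluated with the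
  -- operations of `M`.
  multiple : ℕ → ℕ → ℕ → ℕ
  multiple i m c = (o ⊕ ((⌜ i ⌝ ⊕ o) ⊗ m)) ⊗ c

  opaque
    multipleP : PR 3
    multipleP =
      comp times (comp plus (constant o ∷
        comp times (comp plus (comp numeral (proj fz ∷ []) ∷ constant o ∷ []) ∷ proj (fs fz) ∷ []) ∷ [])
        ∷ proj (fs (fs fz)) ∷ [])

    Eval-multiple : ∀ i m c → Eval multipleP (i ∷ m ∷ c ∷ []) (multiple i m c)
    Eval-multiple i m c =
      evComp (evComp (Eval-constant o ∷
        evComp (evComp (evComp (evProj ∷ []) (Eval-numeral i) ∷ Eval-constant o ∷ []) (proj₂ ⊕-computable _ _)
          ∷ evProj ∷ []) (proj₂ ⊗-computable _ _) ∷ []) (proj₂ ⊕-computable _ _)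
        ∷ evProj ∷ []) (proj₂ ⊗-computable _ _)

  -- The natural number i is read as a triple (m , b , b′) of elements of M, of which b (for true)
  -- or b′ (for false) is divided by the i-th modulus.
  IsDivision : Bool → ℕ → Vec ℕ 7 → Set
  IsDivision s i (w ∷ v ∷ d ∷ c ∷ b′ ∷ b ∷ m ∷ []) = π m (π b b′) ≡ i ×
    Eval multipleP (i ∷ m ∷ c ∷ []) v × Eval plus (c ∷ d ∷ []) w ×
    E v (if s then b else b′) × E w (if s then b else b′)

  Divides : Bool → ℕ → Set
  Divides s i = Σ (Vec ℕ 7) (IsDivision s i)

  -- The diagonal argument asks only for a formula `equal` that is correct about `E` at standard
  -- numbers; each of the two alternatives for `M` supplies one. The parameter may be a nonstandard
  -- element.
  module _ (parameter : ℕ)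
    (equal : ∀ {n} → Tm n → Tm n → Tm n → BFm n)
    (equal-enumerates : ∀ {I n} {ρ : Envs I n} {p x y k l} → (∀ i → val (ρ ⊙ i) p ≡ parameter) →
       ρ ⊢ x ↦ k → ρ ⊢ y ↦ l → ρ ⊢ equal p x y enumerates E k l) where

    dividesᴮ : ∀ {n} → Bool → Tm n → Tm n → BFm n
    dividesᴮ s p i = ∃ᴮ* 7
      (  constᴮ (πᵗ v6 (πᵗ v5 v4) ≐ wks 7 i)
      ∧ᴮ graph multipleP (wks 7 i ∷ v6 ∷ v3 ∷ []) v1
      ∧ᴮ graph plus (v3 ∷ v2 ∷ []) v0
      ∧ᴮ equal (wks 7 p) v1 (if s then v5 else v4)
      ∧ᴮ equal (wks 7 p) v0 (if s then v5 else v4))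

    en-divides : ∀ {I n} {ρ : Envs I n} s {p x i} → (∀ j → val (ρ ⊙ j) p ≡ parameter) →
      ρ ⊢ x ↦ i → ρ ⊢ dividesᴮ s p x enumerates Divides s i
    en-divides {ρ = ρ} s {p} {i = i} p≡ x↦ = en-∃* 7 {R = IsDivision s i} λ { ks@(w ∷ v ∷ d ∷ c ∷ b′ ∷ b ∷ m ∷ []) →
      en-∧ (en-const (def-≐ (↦π ↦v6 (↦π ↦v5 ↦v4)) (↦wks ks x↦)))
     (en-∧ (en-graph multipleP (↦wks ks x↦ ∷ ↦v6 ∷ ↦v3 ∷ []) ↦v1)
     (en-∧ (en-graph plus (↦v3 ∷ ↦v2 ∷ []) ↦v0)
     (en-∧ (equal-enumerates (λ j → trans (val-wks {ρ = ρ} ks {j} p) (p≡ j)) ↦v1 (choose s ↦v5 ↦v4))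
           (equal-enumerates (λ j → trans (val-wks {ρ = ρ} ks {j} p) (p≡ j)) ↦v0 (choose s ↦v5 ↦v4))))) }
      where
      choose : ∀ {I n} {ρ : Envs I n} s {t u k l} → ρ ⊢ t ↦ k → ρ ⊢ u ↦ l →
        ρ ⊢ (if s then t else u) ↦ (if s then k else l)
      choose true  p _ = p
      choose false _ q = q

    opaque
      -- The variables are `i` and the parameter. The name tells which set `i` is sent to: division
      -- of the second number `b′` sends `i` to the first set, and this reversal is the diagonal
      -- step.
      inFirst : Fm 2
      inFirst = before (dividesᴮ false v2 v1) (dividesᴮ true v3 v2)

    InFirst : ℕ → Set
    InFirst i = ⌜ i ⌝ ◂ parameter ◂ ε M ⊩ inFirst

    module _ (i : ℕ) where

      private
        en-false : id ◅ env (λ _ → ⌜ i ⌝ ◂ parameter ◂ ε M) ⊢ dividesᴮ false v2 v1 enumerates Divides false i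
        en-false = en-divides false (λ _ → refl) (std λ _ → ≋-refl)

        en-true : proj₁ ◅ proj₂ ◅ env (λ _ → ⌜ i ⌝ ◂ parameter ◂ ε M) ⊢ dividesᴮ true v3 v2 enumerates Divides true i
        en-true = en-divides true (λ _ → refl) (std λ _ → ≋-refl)

      opaque
        unfolding inFirst

        inFirst-intro : Divides false i → ¬ Divides true i → InFirst i
        inFirst-intro = before-intro en-false en-true

        inFirst-elim : ¬ Divides false i → Divides true i → ¬ InFirst i
        inFirst-elim = before-elim en-false en-true

    embed : Fin 2 → Fin 6
    embed fz     = fz
    embed (fs _) = fs (fs (fs (fs (fs fz))))

    -- From `v0` on, the variables are `i`, `b′`, `b`, `m`, the bound and the parameter; `embed`
    -- selects `i` and the parameter.
    separated : Fm 6
    separated =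
      (inFirst′ ⇒' member v0 v3 v2) ∧' (¬' inFirst′ ⇒' member v0 v3 v1) ∧' ¬' (member v0 v3 v2 ∧' member v0 v3 v1)
      where
      inFirst′ : Fm 6
      inFirst′ = ren embed inFirst

    separator : Fm 2
    separator = ∃' ∃' ∃' ∀≤ v3 separated

    module _ {i b′ b m n : ℕ} where

      private
        ρ : Env 6
        ρ = ⌜ i ⌝ ◂ b′ ◂ b ◂ m ◂ n ◂ parameter ◂ ε M

        agree : ∀ j → ρ (embed j) ≡ (⌜ i ⌝ ◂ parameter ◂ ε M) j
        agree fz      = refl
        agree (fs fz) = refl

      separated-intro : (InFirst i → ρ ⊩ member v0 v3 v2) → (¬ InFirst i → ρ ⊩ member v0 v3 v1) →
        ¬ (ρ ⊩ member v0 v3 v2 × ρ ⊩ member v0 v3 v1) → ρ ⊩ separated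
      separated-intro f g h =
        (λ (p , n) → n (f (⊩-ren inFirst agree p))) , (λ (p , n) → n (g (p ∘ ren-⊩ inFirst agree))) , h

      separated-elim : ρ ⊩ separated → ¬ ¬ (InFirst i × ρ ⊩ member v0 v3 v2 × ¬ (ρ ⊩ member v0 v3 v1) ⊎
        ¬ InFirst i × ¬ (ρ ⊩ member v0 v3 v2) × ρ ⊩ member v0 v3 v1)
      separated-elim (f , g , h) k = ¬¬-excluded-middle λ
        { (yes p) → f (ren-⊩ inFirst agree p , λ q → k (inj₁ (p , q , λ r → h (q , r))))
        ; (no ¬p) → g (¬p ∘ ⊩-ren inFirst agree , λ r → k (inj₂ (¬p , (λ q → h (q , r)) , r))) }

    -- The goal is a negation, so `InFirst` may be decided classically for the finitely many
    -- `i ≤ n`. The two complementary sets obtained are then coded with the common `m = n !`.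
    separator-standard : ∀ n → ⌜ n ⌝ ◂ parameter ◂ ε M ⊩ separator
    separator-standard n none = ¬¬-∀≤ n (λ i _ → ¬¬-excluded-middle {A = InFirst i}) λ decide →
      let P : ℕ → Set
          P i = i ≤ n × InFirst i
          Q : ℕ → Set
          Q i = i ≤ n × ¬ InFirst i
          (b  , b-codes)  = code-set P (λ i → decideBelow (λ i≤n → decide i i≤n) (i ≤? n)) n
          (b′ , b′-codes) = code-set Q (λ i → decideBelow (λ i≤n → ¬? (decide i i≤n)) (i ≤? n)) n
          mem : ∀ i b′ b → i ◃ b′ ◃ b ◃ n ! ◃ n ◃ env {⊤} (λ _ → parameter ◂ ε M) ⊢ member v0 v3 v2 defines Member i (n !) b
          mem i b′ b = def-member ↦v0 ↦v3 ↦v2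
          mem′ : ∀ i b′ b → i ◃ b′ ◃ b ◃ n ! ◃ n ◃ env {⊤} (λ _ → parameter ◂ ε M) ⊢ member v0 v3 v1 defines Member i (n !) b′
          mem′ i b′ b = def-member ↦v0 ↦v3 ↦v1
      in none ⌜ n ! ⌝ λ none → none ⌜ b ⌝ λ none → none ⌜ b′ ⌝ (∀≤-intro-std {n = n} v3 separated ≋-refl λ i i≤n →
        separated-intro {i}
          (λ p → D.complete (mem i b′ b) (proj₁ (b-codes i i≤n) (i≤n , p)) tt)
          (λ ¬p → D.complete (mem′ i b′ b) (proj₁ (b′-codes i i≤n) (i≤n , ¬p)) tt)
          (λ (q , r) → D.sound (mem i b′ b) tt q λ q → D.sound (mem′ i b′ b) tt r λ r →
            proj₂ (proj₂ (b′-codes i i≤n) r) (proj₂ (proj₂ (b-codes i i≤n) q))))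
      where
      decideBelow : ∀ {i} {A : Set} → (i ≤ n → Dec A) → Dec (i ≤ n) → Dec (i ≤ n × A)
      decideBelow d (no i≰n)  = no (i≰n ∘ proj₁)
      decideBelow d (yes i≤n) with d i≤n
      ... | yes a = yes (i≤n , a)
      ... | no ¬a = no (¬a ∘ proj₂)

    module _ {N} {ρ : Env N} {x m b : Tm N} {i : ℕ} (x↦ : val ρ x ≋ ⌜ i ⌝) where

      private
        multiple-val : ∀ c → val (c ◂ ρ) ((1' +' (wk x +' 1') *' wk m) *' v0) ≋ multiple i (val ρ m) c
        multiple-val c = ⊗-cong (⊕-cong ≋-refl (⊗-cong (⊕-cong (val-wk≋ x x↦) ≋-refl) (val-wk≋ m ≋-refl))) ≋-refl

      -- The carrier is `ℕ`, so even nonstandard witnesses `c` and `d` are named by natural numbers.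
      -- Divisibility inside `M` thereby becomes an external existential statement about computed
      -- values and `E`.
      member⇒divides : ρ ⊩ member x m b →
        ¬ ¬ (Σ ℕ λ c → Σ ℕ λ d → E (multiple i (val ρ m) c) (val ρ b) × E (c ⊕ d) (val ρ b))
      member⇒divides h none = ∃≤-elim b (memberVia x m b) h λ (c , d , le , eq) →
        le λ le → (≋-sym (multiple-val c) ∙ eq ∙ val-wk≋ b ≋-refl) λ eq → none (c , d , eq , le)

      divides⇒member : ∀ c d → E (multiple i (val ρ m) c) (val ρ b) → E (c ⊕ d) (val ρ b) → ρ ⊩ member x m b
      divides⇒member c d eq le = ∃≤-intro b (memberVia x m b) c d (λ k → k le)
        (multiple-val c ∙ (λ k → k eq) ∙ ≋-sym (val-wk≋ b ≋-refl))

    module _ (m b b′ : ℕ) where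

      private
        i = π m (π b b′)

      divides-intro : ∀ s c d → E (multiple i m c) (if s then b else b′) → E (c ⊕ d) (if s then b else b′) → Divides s i
      divides-intro s c d eq le = c ⊕ d ∷ multiple i m c ∷ d ∷ c ∷ b′ ∷ b ∷ m ∷ [] ,
        refl , Eval-multiple i m c , proj₂ ⊕-computable c d , eq , le

      divides-elim : ∀ s → Divides s i →
        Σ ℕ λ c → Σ ℕ λ d → E (multiple i m c) (if s then b else b′) × E (c ⊕ d) (if s then b else b′)
      divides-elim s (w ∷ v ∷ d ∷ c ∷ b₁′ ∷ b₁ ∷ m₁ ∷ [] , code , ev-v , ev-w , eq , le)
        with refl , code′ ← π-injective m₁ (π b₁ b₁′) m (π b b′) code
        with refl , refl ← π-injective b₁ b₁′ b b′ code′ =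
        c , d , subst (λ v → E v _) (Eval-deterministic ev-v (Eval-multiple i m c)) eq ,
                subst (λ w → E w _) (Eval-deterministic ev-w (proj₂ ⊕-computable c d)) le

    diagonal-contradiction : ⊥
    diagonal-contradiction =
      overspill nonstandard separator (parameter ◂ ε M) separator-standard λ (a , a-nonstd , sat) →
      sat λ m sat → sat λ b sat → sat λ b′ sat →
      -- The number of the triple obtained by overspill is now used as an index into that triple's
      -- own sets.
      let i = π m (π b b′)
          ρ : Env 6
          ρ = ⌜ i ⌝ ◂ b′ ◂ b ◂ m ◂ a ◂ parameter ◂ ε M
          to : ∀ s {t} → val ρ t ≡ (if s then b else b′) → ρ ⊩ member v0 v3 t → ¬ ¬ Divides s i
          to s {t} t≡ h = ¬¬-map (λ (c , d , eq , le) → divides-intro m b b′ s c d (subst (E _) t≡ eq) (subst (E _) t≡ le))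
            (member⇒divides {x = v0} {v3} {t} {i} ≋-refl h)
          from : ∀ s {t} → val ρ t ≡ (if s then b else b′) → Divides s i → ρ ⊩ member v0 v3 t
          from s {t} t≡ h = let (c , d , eq , le) = divides-elim m b b′ s h in
            divides⇒member {x = v0} {v3} {t} {i} ≋-refl c d (subst (E _) (sym t≡) eq) (subst (E _) (sym t≡) le)
      in
      -- The index is standard and `a` is not, so the separation applies to it.
      nonstandard⇒≥⌜⌝ a-nonstd i λ (c , i≤a) →
      separated-elim {i} (∀≤-elim v3 separated sat ⌜ i ⌝ c i≤a) λ
        -- In either case exactly one of `b`, `b′` is divided, so the comparison is correct at `i`
        -- and gives the opposite of the truth value assumed for `inFirst`.
        { (inj₁ (p , q , ¬r)) → to true {v2} refl q λ d → inFirst-elim i (¬r ∘ from false {v1} refl) d p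
        ; (inj₂ (¬p , ¬q , r)) → to false {v1} refl r λ d → ¬p (inFirst-intro i d (¬q ∘ from true {v2} refl)) }

-- Codes of programs

pair-suc : ∀ x y → pair (suc x) y ≡ 2 * pair x y
pair-suc x y = *-assoc 2 (2 ^ x) (2 * y + 1)

pair-zero : ∀ y → pair 0 y ≡ suc (2 * y)
pair-zero y = trans (*-identityˡ (2 * y + 1)) (+-comm (2 * y) 1)

pair-injective : ∀ x y x′ y′ → pair x y ≡ pair x′ y′ → x ≡ x′ × y ≡ y′
pair-injective zero y zero y′ eq =
  refl , *-cancelˡ-≡ y y′ 2 (suc-injective (trans (sym (pair-zero y)) (trans eq (pair-zero y′))))
pair-injective zero y (suc x′) y′ eq =
  ⊥-elim (even≢odd (pair x′ y′) y (trans (sym (pair-suc x′ y′)) (trans (sym eq) (pair-zero y))))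
pair-injective (suc x) y zero y′ eq =
  ⊥-elim (even≢odd (pair x y) y′ (trans (sym (pair-suc x y)) (trans eq (pair-zero y′))))
pair-injective (suc x) y (suc x′) y′ eq =
  let (x≡ , y≡) = pair-injective x y x′ y′
        (*-cancelˡ-≡ (pair x y) (pair x′ y′) 2 (trans (sym (pair-suc x y)) (trans eq (pair-suc x′ y′))))
  in cong suc x≡ , y≡

pair≢0 : ∀ x y → pair x y ≢ 0
pair≢0 zero    y eq = 1+n≢0 (trans (sym (pair-zero y)) eq)
pair≢0 (suc x) y eq = [ (λ ()) , pair≢0 x y ] (m*n≡0⇒m≡0∨n≡0 2 (trans (sym (pair-suc x y)) eq))

tag body : ∀ {n} → PR n → ℕ
tag Z          = 0
tag S          = 1
tag (proj _)   = 2
tag (comp _ _) = 3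
tag (prim _ _) = 4
tag (mu _)     = 5
body Z           = 0
body S           = 0
body (proj i)    = toℕ i
body (comp f gs) = pair (code f) (codes gs)
body (prim f g)  = pair (code f) (code g)
body (mu f)      = code f

code-split : ∀ {n} (e : PR n) → code e ≡ pair (tag e) (body e)
code-split Z          = refl
code-split S          = refl
code-split (proj _)   = refl
code-split (comp _ _) = refl
code-split (prim _ _) = refl
code-split (mu _)     = refl

mutual
  code-injective : ∀ {n} (e e′ : PR n) → code e ≡ code e′ → e ≡ e′
  code-injective e e′ eq =
    let (t≡ , b≡) = pair-injective (tag e) (body e) (tag e′) (body e′)
                      (trans (sym (code-split e)) (trans eq (code-split e′)))
    in tag-body-injective e e′ t≡ b≡

  tag-body-injective : ∀ {n} (e e′ : PR n) → tag e ≡ tag e′ → body e ≡ body e′ → e ≡ e′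
  tag-body-injective Z Z refl _ = refl
  tag-body-injective S S refl _ = refl
  tag-body-injective (proj i) (proj j) refl eq = cong proj (toℕ-injective eq)
  tag-body-injective (comp f gs) (comp f′ gs′) refl eq
    with f≡ , gs≡ ← pair-injective (code f) (codes gs) (code f′) (codes gs′) eq
    with refl ← codes-injective gs gs′ gs≡ = cong (λ f → comp f gs) (code-injective f f′ f≡)
  tag-body-injective (prim f g) (prim f′ g′) refl eq =
    let (f≡ , g≡) = pair-injective (code f) (code g) (code f′) (code g′) eq
    in cong₂ prim (code-injective f f′ f≡) (code-injective g g′ g≡)
  tag-body-injective (mu f) (mu f′) refl eq = cong mu (code-injective f f′ eq)

  -- The inner arity of `comp f gs` is not visible in its type, so the lengths may differ a priori;
  -- equality of dependent pairs recovers them.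
  codes-injective : ∀ {n m m′} (gs : Vec (PR n) m) (gs′ : Vec (PR n) m′) →
    codes gs ≡ codes gs′ → _≡_ {A = Σ ℕ (Vec (PR n))} (m , gs) (m′ , gs′)
  codes-injective [] [] _ = refl
  codes-injective [] (g ∷ gs) eq = ⊥-elim (pair≢0 (code g) (codes gs) (sym eq))
  codes-injective (g ∷ gs) [] eq = ⊥-elim (pair≢0 (code g) (codes gs) eq)
  codes-injective (g ∷ gs) (g′ ∷ gs′) eq
    with g≡ , gs≡ ← pair-injective (code g) (codes gs) (code g′) (codes gs′) eq
    with refl ← codes-injective gs gs′ gs≡ | refl ← code-injective g g′ g≡ = refl

-- Programs computing the pairing function

addition multiplication : PR 2
addition       = prim (proj fz) (comp S (proj (fs fz) ∷ []))
multiplication = prim (constant 0) (comp addition (proj (fs (fs fz)) ∷ proj (fs fz) ∷ []))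

power : PR 1
power = prim (constant 1) (comp multiplication (constant 2 ∷ proj (fs fz) ∷ []))

pairing : PR 2
pairing = comp multiplication
  (comp power (proj fz ∷ []) ∷ comp addition (comp multiplication (constant 2 ∷ proj (fs fz) ∷ []) ∷ constant 1 ∷ []) ∷ [])

Eval-addition : ∀ a b → Eval addition (a ∷ b ∷ []) (a + b)
Eval-addition zero    b = evPrim0 evProj
Eval-addition (suc a) b = evPrimS (Eval-addition a b) (evComp (evProj ∷ []) evS)

Eval-multiplication : ∀ a b → Eval multiplication (a ∷ b ∷ []) (a * b)
Eval-multiplication zero    b = evPrim0 (Eval-constant 0)
Eval-multiplication (suc a) b =
  evPrimS (Eval-multiplication a b) (evComp (evProj ∷ evProj ∷ []) (Eval-addition b (a * b)))

Eval-power : ∀ a → Eval power (a ∷ []) (2 ^ a)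
Eval-power zero    = evPrim0 (Eval-constant 1)
Eval-power (suc a) =
  evPrimS (Eval-power a) (evComp (Eval-constant 2 ∷ evProj ∷ []) (Eval-multiplication 2 (2 ^ a)))

Eval-pairing : ∀ a b → Eval pairing (a ∷ b ∷ []) (pair a b)
Eval-pairing a b = evComp
  (evComp (evProj ∷ []) (Eval-power a) ∷
   evComp (evComp (Eval-constant 2 ∷ evProj ∷ []) (Eval-multiplication 2 b) ∷ Eval-constant 1 ∷ [])
     (Eval-addition (2 * b) 1) ∷ [])
  (Eval-multiplication (2 ^ a) (2 * b + 1))

comp-pairing : ∀ {n} → PR n → PR n → PR n
comp-pairing f g = comp pairing (f ∷ g ∷ [])

Eval-comp-pairing : ∀ {n} {f g : PR n} {xs a b} → Eval f xs a → Eval g xs b → Eval (comp-pairing f g) xs (pair a b)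
Eval-comp-pairing ev ev′ = evComp (ev ∷ ev′ ∷ []) (Eval-pairing _ _)

-- Hard-wiring arguments: an instance of the s-m-n theorem

-- The input is ignored, so halting on the program's own code, as `HaltingSet` asks, amounts to `e`
-- halting on `k` and `l`.
specialise : PR 2 → ℕ → ℕ → PR 1
specialise e k l = comp e (constant k ∷ constant l ∷ [])

specialise-halts⁺ : ∀ {e k l x} → Halts e (k ∷ l ∷ []) → Halts (specialise e k l) (x ∷ [])
specialise-halts⁺ {k = k} {l} (v , ev) = v , evComp (Eval-constant k ∷ Eval-constant l ∷ []) ev

specialise-halts⁻ : ∀ {e k l x} → Halts (specialise e k l) (x ∷ []) → Halts e (k ∷ l ∷ [])
specialise-halts⁻ {k = k} {l} (v , evComp (ev₁ ∷ ev₂ ∷ []) ev)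
  with refl ← Eval-deterministic ev₁ (Eval-constant k) | refl ← Eval-deterministic ev₂ (Eval-constant l) = v , ev

opaque
  -- Unwinds `constant` at the level of codes: 3 is the tag of `comp`, and the final 0 is the code
  -- of the empty vector.
  constantCode : PR 1
  constantCode = prim (constant (code {1} (constant 0)))
    (comp-pairing (constant 3) (comp-pairing (constant (code S)) (comp-pairing (proj (fs fz)) (constant 0))))

  Eval-constantCode : ∀ k → Eval constantCode (k ∷ []) (code {1} (constant k))
  Eval-constantCode zero    = evPrim0 (Eval-constant (code {1} (constant 0)))
  Eval-constantCode (suc k) = evPrimS (Eval-constantCode k)
    (Eval-comp-pairing (Eval-constant 3) (Eval-comp-pairing (Eval-constant (code S))
      (Eval-comp-pairing evProj (Eval-constant 0))))

  specialiseCode : PR 2 → PR 2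
  specialiseCode e = comp-pairing (constant 3) (comp-pairing (constant (code e))
    (comp-pairing (comp constantCode (proj fz ∷ []))
      (comp-pairing (comp constantCode (proj (fs fz) ∷ [])) (constant 0))))

  Eval-specialiseCode : ∀ e k l → Eval (specialiseCode e) (k ∷ l ∷ []) (code (specialise e k l))
  Eval-specialiseCode e k l = Eval-comp-pairing (Eval-constant 3) (Eval-comp-pairing (Eval-constant (code e))
    (Eval-comp-pairing (evComp (evProj ∷ []) (Eval-constantCode k))
      (Eval-comp-pairing (evComp (evProj ∷ []) (Eval-constantCode l)) (Eval-constant 0))))

HaltingSet-specialise⁺ : ∀ {e} k l → Halts e (k ∷ l ∷ []) → HaltingSet (code (specialise e k l))
HaltingSet-specialise⁺ {e} k l h = specialise e k l , refl , specialise-halts⁺ h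

HaltingSet-specialise⁻ : ∀ {e} k l → HaltingSet (code (specialise e k l)) → Halts e (k ∷ l ∷ [])
HaltingSet-specialise⁻ {e} k l (e′ , code≡ , h)
  with refl ← code-injective e′ (specialise e k l) code≡ = specialise-halts⁻ h

-- Defining E on standard numbers

ℕ-ModelPA : ModelPA ℕ-Str
ℕ-ModelPA =
  (λ a p → p λ eq → 1+n≢0 (trans (+-comm 1 a) eq)) ,
  (λ a b (p , q) → p λ eq → q λ k → k (+-cancelʳ-≡ 1 a b eq)) ,
  (λ a k → k (+-identityʳ a)) ,
  (λ a b k → k (sym (+-assoc a b 1))) ,
  (λ a k → k (*-zeroʳ a)) ,
  (λ a b k → k (trans (*-distribˡ-+ a b 1) (cong (a * b +_) (*-identityʳ a)))) ,
  induct
  where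
  induct : ∀ {n} (φ : Fm (suc n)) ρ → Sat ℕ-Str φ (extend ℕ-Str 0 ρ) →
    (∀ a → Sat ℕ-Str φ (extend ℕ-Str a ρ) → Sat ℕ-Str φ (extend ℕ-Str (a + 1) ρ)) →
    ∀ a → Sat ℕ-Str φ (extend ℕ-Str a ρ)
  induct φ ρ p₀ next zero    = p₀
  induct φ ρ p₀ next (suc a) =
    subst (λ a → Sat ℕ-Str φ (extend ℕ-Str a ρ)) (+-comm a 1) (next a (induct φ ρ p₀ next a))

module ℕ-Model = Model ℕ-Str ≡.isEquivalence (cong₂ _+_) (cong₂ _*_) ℕ-ModelPA

num-ℕ : ∀ n → num ℕ-Str n ≡ n
num-ℕ zero    = refl
num-ℕ (suc n) = trans (cong (_+ 1) (num-ℕ n)) (+-comm n 1)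

-- Absoluteness applied to `ℕ-Str` itself, where the bound `s` found by the sentence is standard.
haltingSentence-true : ∀ {e k l} → ℕ-Str ⊨ haltingSentence e k l → ¬ ¬ Halts e (k ∷ l ∷ [])
haltingSentence-true {e} {k} {l} sat none =
  sat λ x sat → sat λ y sat → sat λ s (x≡ , y≡ , h) →
  ℕ-Model.En.sound
    (ℕ-Model.en-halting {ρ = ℕ-Model.env {⊤} λ _ → s ◂ y ◂ x ◂ ε ℕ-Str}
      (std λ _ → x≡ ∙ ≋-reflexive (ℕ-Model.val-numᵗ k)) (std λ _ → y≡ ∙ ≋-reflexive (ℕ-Model.val-numᵗ l)))
    tt v0 s (≋-reflexive (sym (num-ℕ s))) h none
  where open ℕ-Model

module Presentation (_⊕_ _⊗_ : ℕ → ℕ → ℕ) (E : ℕ → ℕ → Set)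
  (⊕-computable : Computable₂ _⊕_) (⊗-computable : Computable₂ _⊗_) (E-coCE : CoCE₂ E)
  (E-equiv : IsEquivalence E) (E-congruence : Congruence₂ E _⊕_ _⊗_) (z o : ℕ)
  (pa : ModelPA (Quotient _⊕_ _⊗_ E z o)) (nonstandard : Nonstandard (Quotient _⊕_ _⊗_ E z o)) where

  open Diagonal _⊕_ _⊗_ E ⊕-computable ⊗-computable E-equiv E-congruence z o pa nonstandard public
  open Model M E-equiv (proj₁ E-congruence) (proj₂ E-congruence) pa

  unequal : PR 2
  unequal = proj₁ E-coCE

  unequal⁺ : ∀ {k l} → ¬ E k l → Halts unequal (k ∷ l ∷ [])
  unequal⁺ {k} {l} = proj₁ (proj₂ E-coCE k l)

  unequal⁻ : ∀ {k l} → Halts unequal (k ∷ l ∷ []) → ¬ E k l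
  unequal⁻ {k} {l} = proj₂ (proj₂ E-coCE k l)

  unequalHalts : ∀ {n} → Tm n → Tm n → Fm (3 + n)
  unequalHalts {n} x y = v2 ≐ wks 3 x ∧' v1 ≐ wks 3 y ∧' ren (_↑ˡ n) (halting unequal ⟨ v0 ⟩)

  equalIfSound : ∀ {n} → Tm n → Tm n → Tm n → BFm n
  equalIfSound _ x y = constᴮ (¬' ∃' ∃' ∃' unequalHalts x y)

  module _ {n} {s b a : ℕ} {ρ : Env n} where

    agree : ∀ j → (s ◂ b ◂ a ◂ ρ) (j ↑ˡ n) ≡ (s ◂ b ◂ a ◂ ε M) j
    agree fz           = refl
    agree (fs fz)      = refl
    agree (fs (fs fz)) = refl

    val-wk³ : ∀ t {k} → val ρ t ≋ ⌜ k ⌝ → val (s ◂ b ◂ a ◂ ρ) (wks 3 t) ≋ ⌜ k ⌝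
    val-wk³ t p = val-wk≋ (wks 2 t) (val-wk≋ (wks 1 t) (val-wk≋ t p))

  -- If `E k l` fails, the actual halting computation is reproduced inside `M`. If it holds,
  -- soundness turns any computation found in `M`, possibly a nonstandard one, into an actual one,
  -- which is absurd.
  equalIfSound-enumerates : Σ₁-Sound M → ∀ {I n} {ρ : Envs I n} {p x y k l} → (∀ i → val (ρ ⊙ i) p ≡ 0) →
    ρ ⊢ x ↦ k → ρ ⊢ y ↦ l → ρ ⊢ equalIfSound p x y enumerates E k l
  equalIfSound-enumerates Σ₁-sound {ρ = ρ} {x = x} {y} {k} {l} _ (std x↦) (std y↦) =
    en-const (mkDefines sound complete)
    where
    φ : Fm _
    φ = ¬' ∃' ∃' ∃' unequalHalts x y
    sound : ∀ i → ρ ⊙ i ⊩ φ → ¬ ¬ E k l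
    sound i h ¬Ekl =
      En.complete (en-halting {ρ = id ◅ l ◃ k ◃ env λ _ → ε M} ↦₂ ↦₁) (unequal⁺ ¬Ekl) λ (s , f) →
      h λ none → none ⌜ k ⌝ λ none → none ⌜ l ⌝ λ none → none ⌜ s ⌝
        ( ≋-sym (val-wk³ x {k} (x↦ i)) , ≋-sym (val-wk³ y {l} (y↦ i))
        , ren-⊩ (halting unequal ⟨ v0 ⟩) agree (f ⌜ s ⌝ v0 s ≋-refl ≤-refl) )
      where
      ↦₂ : id ◅ l ◃ k ◃ env (λ _ → ε M) ⊢ v2 ↦ k
      ↦₂ = std λ _ → ≋-refl
      ↦₁ : id ◅ l ◃ k ◃ env (λ _ → ε M) ⊢ v1 ↦ l
      ↦₁ = std λ _ → ≋-refl
    complete : E k l → ∀ i → ρ ⊙ i ⊩ φ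
    complete Ekl i h = h λ a h → h λ b h → h λ s (a≋ , b≋ , halts) →
      haltingSentence-true {unequal} {k} {l}
        (Σ₁-sound (haltingSentence unequal k l) (haltingSentence-Σ₁ unequal k l)
          λ none → none a λ none → none b λ none → none s
            ( a≋ ∙ val-wk³ x {k} (x↦ i) ∙ ≋-reflexive (sym (val-numᵗ k))
            , b≋ ∙ val-wk³ y {l} (y↦ i) ∙ ≋-reflexive (sym (val-numᵗ l))
            , ⊩-ren (halting unequal ⟨ v0 ⟩) agree halts ))
        λ h → unequal⁻ h Ekl

  index : ℕ → ℕ → ℕ
  index k l = code (specialise unequal k l)

  isIndexPrime : ∀ {n} → Tm n → Tm n → Tm n → BFm n
  isIndexPrime x y q = ∃ᴮ
    (graph (specialiseCode unequal) (wk x ∷ wk y ∷ []) v0 ∧ᴮ primeCountᴮ (wk q) v0 ∧ᴮ constᴮ (primeᶠ (wk q)))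

  en-isIndexPrime : ∀ {I n} {ρ : Envs I n} {x y q k l p} → ρ ⊢ x ↦ k → ρ ⊢ y ↦ l → ρ ⊢ q ↦ p →
    ρ ⊢ isIndexPrime x y q enumerates NthPrime (index k l) p
  en-isIndexPrime {k = k} {l} {p} x↦ y↦ q↦ = en-map
    (λ (v , ev , count , pr) → IsPrime⇒prime pr ,
       trans (Iter⇒primeCount count) (Eval-deterministic ev (Eval-specialiseCode unequal k l)))
    (λ (pr , count) → index k l , Eval-specialiseCode unequal k l ,
       subst (Iter _ _ p) count (primeCount⇒Iter p) , prime⇒IsPrime pr)
    (en-∃ λ v → en-∧ (en-graph (specialiseCode unequal) (↦wk x↦ ∷ ↦wk y↦ ∷ []) ↦v0)
      (en-∧ (en-primeCount (↦wk q↦) ↦v0) (en-const (def-prime (↦wk q↦)))))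

  -- The prime and its index are sought below the bound of the approximation, whereas the cofactor
  -- ranges over all of `M`, as divisibility of a nonstandard parameter requires.
  equalByJump : ∀ {n} → Tm n → Tm n → Tm n → BFm n
  equalByJump p x y = ∃ᴮ (isIndexPrime (wk x) (wk y) v0 ∧ᴮ constᴮ (¬' ∃' (v1 *' v0 ≐ wks 2 p)))

  module _ (a : ℕ) (jump : ∀ n p → NthPrime n p →
      (¬ ¬ HaltingSet n → DividesIn M ⌜ p ⌝ a) × (DividesIn M ⌜ p ⌝ a → ¬ ¬ HaltingSet n)) where

    def-nondivisor : ∀ {I n} {ρ : Envs I n} {t q} → (∀ i → val (ρ ⊙ i) t ≡ a) →
      q ◃ ρ ⊢ ¬' ∃' (v1 *' v0 ≐ wks 2 t) defines (¬ DividesIn M ⌜ q ⌝ a)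
    def-nondivisor {ρ = ρ} {t} {q} t≡ = mkDefines
      (λ i h k → k λ d → h λ none → d λ c eq → none c λ ne → ne (subst (E _) (sym (t≡a i)) eq))
      λ nd i h → nd λ none → h λ c eq → eq λ eq → none c (subst (E _) (t≡a i) eq)
      where
      t≡a : ∀ i {c} → val (c ◂ ⌜ q ⌝ ◂ ρ ⊙ i) (wks 2 t) ≡ a
      t≡a i = trans (val-wk (wk t)) (trans (val-wk t) (t≡ i))

    equalByJump-enumerates : ∀ {I n} {ρ : Envs I n} {p x y k l} → (∀ i → val (ρ ⊙ i) p ≡ a) →
      ρ ⊢ x ↦ k → ρ ⊢ y ↦ l → ρ ⊢ equalByJump p x y enumerates E k l
    equalByJump-enumerates {k = k} {l} p≡ x↦ y↦ = en-¬¬map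
      (λ (p , nth , nd) ¬Ekl → nd (proj₁ (jump _ p nth) λ k → k (HaltingSet-specialise⁺ _ _ (unequal⁺ ¬Ekl))))
      (λ Ekl → let (p , nth) = nthPrime (index k l) in
        p , nth , λ d → proj₂ (jump _ p nth) d λ h → unequal⁻ (HaltingSet-specialise⁻ k l h) Ekl)
      (en-∃ λ q → en-∧ (en-isIndexPrime (↦wk x↦) (↦wk y↦) ↦v0) (en-const (def-nondivisor p≡)))

theorem6 : (_⊕_ _⊗_ : ℕ → ℕ → ℕ) (E : ℕ → ℕ → Set) →
    Computable₂ _⊕_ → Computable₂ _⊗_ →
    CoCE₂ E → IsEquivalence E → Congruence₂ E _⊕_ _⊗_ →
    (z o : ℕ) →
    ModelPA (Quotient _⊕_ _⊗_ E z o) →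
    Nonstandard (Quotient _⊕_ _⊗_ E z o) →
    Σ₁-Sound (Quotient _⊕_ _⊗_ E z o) ⊎ ZeroJumpInSSy (Quotient _⊕_ _⊗_ E z o) →
    ⊥
theorem6 _⊕_ _⊗_ E ⊕-comp ⊗-comp E-coCE E-equiv E-congr z o pa nonstandard =
  -- Here 0 is a placeholder for the parameter; in the other case the parameter is the element
  -- coding the halting set.
  [ (λ Σ₁-sound → diagonal-contradiction 0 equalIfSound (λ {_} {_} {_} {p} → equalIfSound-enumerates Σ₁-sound {p = p}))
  , (λ jump → jump λ a a-codes → diagonal-contradiction a equalByJump (equalByJump-enumerates a a-codes)) ]
  where
  open Presentation _⊕_ _⊗_ E ⊕-comp ⊗-comp E-coCE E-equiv E-congr z o pa nonstandard
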